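{- Let $n\ge 4$ and let $BS_n$ be the $n$-dimensional bubble-sort star graph. Then $BS_n$ is $(6n-17)$-conditional edge-fault-tolerant strongly Menger edge connected, i.e., for every $F_e\subseteq E(BS_n)$ with $|F_e|\le 6n-17$ and $\delta(BS_n-F_e)\ge 2$, the graph $BS_n-F_e$ is strongly Menger edge connected. Moreover, the bound $6n-17$ is sharp: there exists $F_e\subseteq E(BS_n)$ with $|F_e|=6n-16$ and $\delta(BS_n-F_e)\ge2$ such that $BS_n-F_e$ is not strongly Menger edge connected.
   Context: The $n$-dimensional bubble-sort star graph $BS_n$ has as vertex set all permutations $x=x_1x_2\cdots x_n$ of $\{1,\dots,n\}$. Two distinct vertices $x,y$ are adjacent iff there is $k\in\{2,\dots,n\}$ such that $y$ is obtained from $x$ either by swapping the entries in positions $k-1$ and $k$, or by swapping the entries in positions $1$ and $k$. ($BS_n$ is bipartite and $(2n-3)$-regular with $n!$ vertices.) For $F_e\subseteq E(G)$, $G-F_e$ is the graph with vertex set $V(G)$ and edge set $E(G)\setminus F_e$; $\delta(\cdot)$ denotes minimum degree. A graph $G$ is strongly Menger edge connected if for any two distinct vertices $u,v$ of $G$ there exist $\min\{d_G(u),d_G(v)\}$ pairwise edge-disjoint $(u,v)$-paths in $G$. For an integer $m\ge1$, $G$ is $m$-conditional edge-fault-tolerant strongly Menger edge connected if $G-F_e$ is strongly Menger edge connected for every $F_e\subseteq E(G)$ with $|F_e|\le m$ and $\delta(G-F_e)\ge 2$. -}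

module Defs where

open import Data.Nat using (ℕ; zero; suc; _<_; _≤_)
open import Data.Nat.Properties using (_≟_; _<?_)
open import Data.Fin using (Fin; toℕ)
import Data.Fin.Properties as FinP
open import Data.Vec using (Vec; lookup; _[_]≔_)
import Data.Vec.Properties as VecP
open import Data.List using (List; []; _∷_; map; filter; deduplicate; length; cartesianProduct; allFin)
open import Data.List.Membership.Propositional using (_∈_)
open import Data.List.Membership.DecPropositional using () renaming (_∈?_ to ∈?-gen)
open import Data.List.Relation.Unary.Unique.Propositional using (Unique)
open import Data.Product using (Σ; _×_; _,_; proj₁; proj₂)
import Data.Product.Properties as ProdP
open import Data.Sum using (_⊎_)
open import Relation.Nullary using (¬_; Dec; ¬?)
open import Relation.Nullary.Decidable using (_⊎-dec_; _×-dec_)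
open import Relation.Binary.PropositionalEquality using (_≡_; _≢_)
open import Relation.Binary.Definitions using (DecidableEquality)

-- Vertices: words x = x₁⋯xₙ over {1..n} (encoded as Fin n, positions 0-based);
-- the vertices of BS_n are those words that are permutations.
V : ℕ → Set
V n = Vec (Fin n) n

IsPerm : ∀ {n} → V n → Set
IsPerm {n} x = ∀ (i j : Fin n) → lookup x i ≡ lookup x j → i ≡ j

_≟V_ : ∀ {n} → DecidableEquality (V n)
_≟V_ = VecP.≡-dec FinP._≟_

swap : ∀ {n} → V n → Fin n → Fin n → V n
swap x i j = (x [ i ]≔ lookup x j) [ j ]≔ lookup x i

-- generating transpositions of BS_n (0-based positions):
-- (k-1,k) for k = 2..n  (bubble-sort), and (1,k) for k = 2..n (star)
Allowed : ∀ {n} → Fin n → Fin n → Set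
Allowed i j = (toℕ j ≡ suc (toℕ i)) ⊎ ((toℕ i ≡ 0) × (0 < toℕ j))

Allowed? : ∀ {n} (i j : Fin n) → Dec (Allowed i j)
Allowed? i j = (toℕ j ≟ suc (toℕ i)) ⊎-dec ((toℕ i ≟ 0) ×-dec (0 <? toℕ j))

Adj : ∀ {n} → V n → V n → Set
Adj {n} x y = (x ≢ y) × Σ (Fin n) λ i → Σ (Fin n) λ j → Allowed i j × (y ≡ swap x i j)

-- an edge (as an ordered pair of endpoints) and fault sets as lists of edges
Edge : ℕ → Set
Edge n = V n × V n

EdgeIn : ∀ {n} → List (Edge n) → V n → V n → Set
EdgeIn F x y = ((x , y) ∈ F) ⊎ ((y , x) ∈ F)

_≟E_ : ∀ {n} → DecidableEquality (Edge n)
_≟E_ = ProdP.≡-dec _≟V_ _≟V_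

EdgeIn? : ∀ {n} (F : List (Edge n)) (x y : V n) → Dec (EdgeIn F x y)
EdgeIn? F x y = ∈?-gen _≟E_ (x , y) F ⊎-dec ∈?-gen _≟E_ (y , x) F

IsEdgeSet : ∀ {n} → List (Edge n) → Set
IsEdgeSet {n} F = ∀ (x y : V n) → (x , y) ∈ F → IsPerm x × Adj x y

SameEdge : ∀ {n} → Edge n → Edge n → Set
SameEdge (a , b) (c , d) = ((a ≡ c) × (b ≡ d)) ⊎ ((a ≡ d) × (b ≡ c))

gens : (n : ℕ) → List (Fin n × Fin n)
gens n = filter (λ p → Allowed? (proj₁ p) (proj₂ p)) (cartesianProduct (allFin n) (allFin n))

neighbours : ∀ {n} → List (Edge n) → V n → List (V n)
neighbours {n} F x =
  deduplicate _≟V_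
    (filter (λ y → ¬? (x ≟V y))
      (filter (λ y → ¬? (EdgeIn? F x y))
        (map (λ p → swap x (proj₁ p) (proj₂ p)) (gens n))))

deg : ∀ {n} → List (Edge n) → V n → ℕ
deg F x = length (neighbours F x)

MinDeg≥2 : ∀ {n} → List (Edge n) → Set
MinDeg≥2 {n} F = ∀ (x : V n) → IsPerm x → 2 ≤ deg F x

data Walk {n} (F : List (Edge n)) : V n → V n → List (V n) → Set where
  here : ∀ {u} → Walk F u u (u ∷ [])
  step : ∀ {u w v p} → Adj u w → ¬ EdgeIn F u w → Walk F w v p → Walk F u v (u ∷ p)

IsPath : ∀ {n} → List (Edge n) → V n → V n → List (V n) → Set
IsPath F u v p = Walk F u v p × Unique p

edgesOf : ∀ {n} → List (V n) → List (Edge n)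
edgesOf [] = []
edgesOf (a ∷ []) = []
edgesOf (a ∷ b ∷ p) = (a , b) ∷ edgesOf (b ∷ p)

EdgeDisjoint : ∀ {n} → List (V n) → List (V n) → Set
EdgeDisjoint p q = ∀ e f → e ∈ edgesOf p → f ∈ edgesOf q → ¬ SameEdge e f

open import Data.Nat using (_⊓_)
open import Data.List.Relation.Unary.All using (All)
open import Data.List.Relation.Unary.AllPairs using (AllPairs)

StronglyMengerEdge : ∀ {n} → List (Edge n) → Set
StronglyMengerEdge {n} F =
  (u v : V n) → IsPerm u → IsPerm v → u ≢ v →
  Σ (List (List (V n))) λ ps →
    (length ps ≡ deg F u ⊓ deg F v) × All (IsPath F u v) ps × AllPairs EdgeDisjoint ps

{-# OPTIONS --safe #-}
module Submission where

-- By Menger's theorem it suffices to bound the edge cuts [S, S′] of BS_n − F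
-- that separate u from v. If |S| ≤ 3, bipartiteness leaves at most |S| − 1
-- edges inside S, so δ ≥ 2 gives a cut of at least deg u edges; if |S′| ≤ 3,
-- the same holds for v. Otherwise the cut has at least 8n − 20 edges in BS_n,
-- of which F removes at most 6n − 17, and 2n − 3 ≥ deg u remain. The bound
-- 8n − 20 is proved by induction on n: fixing the last letter splits BS_n into
-- n copies of BS_{n-1}, any two of them joined by 2 (n-2)! edges. It is attained
-- by a 4-cycle; deleting 6n − 16 of the edges leaving the 4-cycle, none of them
-- at its vertex u, leaves a cut of 2n − 4 edges between u, which keeps its full
-- degree 2n − 3, and a distant vertex of full degree.

-- The value 8n - 20 is 4(2n - 3) - 8: four vertices of a bipartite graph span at most four edges.
-- With n = 4 + k it reads 12 + 8k, so the induction must gain 8 at each step. The hypothesis says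
-- nothing about a copy with at most 3 vertices in S (light) or at most 3 outside S (heavy), and
-- this shapes the step. If no copy is heavy and some copy has at least 4 members, that copy
-- supplies the bound of the hypothesis, and the two generators that change the fixed letter supply
-- the missing 8, or else the other copies do. If no copy is light, the complement is treated in the
-- same way. If both kinds occur, almost every edge between a heavy and a light copy is cut, and (n
-- - 2)! edges per pair, half of those available, are enough. Light and heavy exclude each other
-- once a copy has at least 7 vertices; copies of BS_3 have only 6, so n = 4 is left to a finite
-- search. The inequality is stated for arrangements of an arbitrary tuple of distinct letters,
-- since a copy lacks one letter of the alphabet. Menger's theorem is obtained by augmenting paths,
-- with a flow kept as a duplicate-free list of arcs.

open import Defs
open import Data.Bool as Bool using (Bool; T; true; false; not; _∧_; _∨_; _xor_; if_then_else_)
open import Data.Bool.Properties using (∧-comm; not-involutive)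
open import Data.Empty using (⊥)
open import Data.Fin as Fin using (Fin; zero; suc; toℕ; fromℕ; opposite; inject₁)
import Data.Fin.Properties as FinP
open import Data.List using (List; []; _∷_; _++_; _∷ʳ_; map; concatMap; length; filter; filterᵇ; allFin)
open import Data.List.Properties using (length-map; length-++; length-tabulate; map-∘; ++-assoc; ++-identityʳ)
open import Data.List.Membership.DecPropositional using () renaming (_∈?_ to ∈?-dec)
open import Data.List.Membership.Propositional using (_∈_; _∉_; find; lose)
open import Data.List.Membership.Propositional.Properties
open import Data.List.Relation.Binary.Permutation.Propositional as Perm using (_↭_; ↭-refl; ↭-sym; ↭-trans; prep)
open import Data.List.Relation.Binary.Permutation.Propositional.Properties
  using (shift; drop-∷; ↭-length; ∈-resp-↭; All-resp-↭)
open import Data.List.Relation.Binary.Subset.Propositional using (_⊆_)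
open import Data.List.Relation.Unary.All as All using (All; []; _∷_)
open import Data.List.Relation.Unary.All.Properties using (¬Any⇒All¬)
open import Data.List.Relation.Unary.AllPairs as AllPairs using (AllPairs; []; _∷_)
import Data.List.Relation.Unary.AllPairs.Properties as AllPairsP
open import Data.List.Relation.Unary.Any using (here; there; any?)
open import Data.List.Relation.Unary.Unique.DecPropositional.Properties using (deduplicate-!)
open import Data.List.Relation.Unary.Unique.Propositional using (Unique)
open import Data.List.Relation.Unary.Unique.Propositional.Properties using (map⁺; ++⁺; filter⁺; allFin⁺)
open import Data.Maybe using (Maybe; just; nothing)
open import Data.Nat using (ℕ; zero; suc; _+_; _*_; _∸_; _⊓_; _⊔_; _≤_; _<_; _≤?_; _≤ᵇ_; _<ᵇ_; _!; z≤n; s≤s; s≤s⁻¹)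
open import Data.Nat.Properties hiding (_≟_; _<?_)
open import Data.Nat.Tactic.RingSolver using (solve-∀)
open import Data.Product using (Σ; ∃; _×_; _,_; proj₁; proj₂)
open import Data.Product.Properties using (≡-dec)
open import Data.Sum using (_⊎_; inj₁; inj₂)
open import Data.Unit using (tt)
open import Data.Vec as Vec using (Vec; []; _∷_; lookup; _[_]≔_; toList; tabulate; head)
import Data.Vec.Properties as VecP
open import Data.Vec.Properties using
  (lookup∘update; lookup∘update′; lookup∘tabulate; tabulate∘lookup; tabulate-cong; length-toList; lookup-allFin)
open import Relation.Binary.Definitions using (DecidableEquality; tri<; tri≈; tri>)
open import Relation.Binary.PropositionalEquality hiding ([_])
open import Relation.Nullary using (¬_; Dec; yes; no; contradiction; does; ¬?)
open import Relation.Nullary.Decidable using (dec-true; dec-false; _×-dec_)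

-- Finite sums and duplicate-free lists

-- The side condition is a semiring identity, so the ring solver settles
-- linear arithmetic once the right combination P ≤ Q of hypotheses is given.
linear : ∀ {L R P Q} k → P ≤ Q → L + Q + k ≡ R + P → L ≤ R
linear {L} {R} {P} {Q} k h eq = +-cancelʳ-≤ Q L R (begin
  L + Q     ≤⟨ m≤m+n _ k ⟩
  L + Q + k ≡⟨ eq ⟩
  R + P     ≤⟨ +-monoʳ-≤ R h ⟩
  R + Q     ∎)
  where open ≤-Reasoning

infix 9 ⟦_⟧
⟦_⟧ : Bool → ℕ
⟦ true ⟧ = 1
⟦ false ⟧ = 0

module _ {A : Set} where

  ∑ : List A → (A → ℕ) → ℕ
  ∑ [] f = 0
  ∑ (x ∷ xs) f = f x + ∑ xs f

  ∑-cong∈ : ∀ xs {f g : A → ℕ} → (∀ {x} → x ∈ xs → f x ≡ g x) → ∑ xs f ≡ ∑ xs g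
  ∑-cong∈ [] h = refl
  ∑-cong∈ (x ∷ xs) h = cong₂ _+_ (h (here refl)) (∑-cong∈ xs (λ m → h (there m)))

  ∑-cong : ∀ xs {f g : A → ℕ} → (∀ x → f x ≡ g x) → ∑ xs f ≡ ∑ xs g
  ∑-cong xs h = ∑-cong∈ xs (λ {x} _ → h x)

  ∑-mono∈ : ∀ xs {f g : A → ℕ} → (∀ {x} → x ∈ xs → f x ≤ g x) → ∑ xs f ≤ ∑ xs g
  ∑-mono∈ [] h = z≤n
  ∑-mono∈ (x ∷ xs) h = +-mono-≤ (h (here refl)) (∑-mono∈ xs (λ m → h (there m)))

  ∑-mono : ∀ xs {f g : A → ℕ} → (∀ x → f x ≤ g x) → ∑ xs f ≤ ∑ xs g
  ∑-mono xs h = ∑-mono∈ xs (λ {x} _ → h x)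

  ∑-+ : ∀ xs (f g : A → ℕ) → ∑ xs (λ x → f x + g x) ≡ ∑ xs f + ∑ xs g
  ∑-+ [] f g = refl
  ∑-+ (x ∷ xs) f g rewrite ∑-+ xs f g = lemma (f x) (g x) (∑ xs f) (∑ xs g)
    where
    lemma : ∀ a b c d → (a + b) + (c + d) ≡ (a + c) + (b + d)
    lemma = solve-∀

  ∑-*ˡ : ∀ xs c (f : A → ℕ) → ∑ xs (λ x → c * f x) ≡ c * ∑ xs f
  ∑-*ˡ [] c f = sym (*-zeroʳ c)
  ∑-*ˡ (x ∷ xs) c f rewrite ∑-*ˡ xs c f = sym (*-distribˡ-+ c (f x) (∑ xs f))

  ∑-*ʳ : ∀ xs c (f : A → ℕ) → ∑ xs (λ x → f x * c) ≡ ∑ xs f * c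
  ∑-*ʳ [] c f = refl
  ∑-*ʳ (x ∷ xs) c f rewrite ∑-*ʳ xs c f = sym (*-distribʳ-+ c (f x) (∑ xs f))

  ∑-const : ∀ xs c → ∑ xs (λ _ → c) ≡ length xs * c
  ∑-const [] c = refl
  ∑-const (x ∷ xs) c = cong (c +_) (∑-const xs c)

  ∑-1 : ∀ xs → ∑ xs (λ _ → 1) ≡ length xs
  ∑-1 xs = trans (∑-const xs 1) (*-identityʳ _)

  ∑-0 : ∀ xs → ∑ xs (λ _ → 0) ≡ 0
  ∑-0 [] = refl
  ∑-0 (x ∷ xs) = ∑-0 xs

  ∑-++ : ∀ xs ys (f : A → ℕ) → ∑ (xs ++ ys) f ≡ ∑ xs f + ∑ ys f
  ∑-++ [] ys f = refl
  ∑-++ (x ∷ xs) ys f rewrite ∑-++ xs ys f = sym (+-assoc (f x) _ _)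

  ∑-↭ : ∀ {xs ys} (f : A → ℕ) → xs ↭ ys → ∑ xs f ≡ ∑ ys f
  ∑-↭ f Perm.refl = refl
  ∑-↭ f (prep x p) = cong (f x +_) (∑-↭ f p)
  ∑-↭ f (Perm.swap x y p) rewrite ∑-↭ f p = lemma (f x) (f y) _
    where
    lemma : ∀ a b c → a + (b + c) ≡ b + (a + c)
    lemma = solve-∀
  ∑-↭ f (Perm.trans p q) = trans (∑-↭ f p) (∑-↭ f q)

  ∑-member : ∀ {xs x} (f : A → ℕ) → x ∈ xs → f x ≤ ∑ xs f
  ∑-member {y ∷ xs} f (here refl) = m≤m+n _ _
  ∑-member {y ∷ xs} f (there m) = ≤-trans (∑-member f m) (m≤n+m _ _)

  -- Turns an inclusion of sets into a splitting of lists up to permutation. The comparisons of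
  -- cardinalities and of sums over sublists below rest on it.
  unique-⊆⇒↭++ : ∀ {ys xs : List A} → Unique ys → ys ⊆ xs → ∃ λ zs → xs ↭ ys ++ zs
  unique-⊆⇒↭++ {[]} {xs} u s = xs , ↭-refl
  unique-⊆⇒↭++ {y ∷ ys} (y∉ ∷ u) s with ∈-∃++ (s (here refl))
  ... | as , bs , refl = let zs , p = unique-⊆⇒↭++ u sub in
        zs , ↭-trans (shift y as bs) (prep y p)
    where
    sub : ys ⊆ as ++ bs
    sub m with ∈-resp-↭ (shift y as bs) (s (there m))
    ... | here refl = contradiction refl (All.lookup y∉ m)
    ... | there m′ = m′

  ∑-⊆ : ∀ {ys xs} (f : A → ℕ) → Unique ys → ys ⊆ xs → ∑ ys f ≤ ∑ xs f
  ∑-⊆ {ys} f u s = let zs , p = unique-⊆⇒↭++ u s in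
    ≤-trans (m≤m+n _ (∑ zs f)) (≤-reflexive (sym (trans (∑-↭ f p) (∑-++ ys zs f))))

  length-⊆ : ∀ {ys xs : List A} → Unique ys → ys ⊆ xs → length ys ≤ length xs
  length-⊆ {ys} {xs} u s = subst₂ _≤_ (∑-1 ys) (∑-1 xs) (∑-⊆ (λ _ → 1) u s)

module _ {A B : Set} where

  ∑-map : ∀ xs (g : A → B) (f : B → ℕ) → ∑ (map g xs) f ≡ ∑ xs (λ x → f (g x))
  ∑-map [] g f = refl
  ∑-map (x ∷ xs) g f = cong (f (g x) +_) (∑-map xs g f)

  ∑-concatMap : ∀ xs (g : A → List B) (f : B → ℕ) → ∑ (concatMap g xs) f ≡ ∑ xs (λ x → ∑ (g x) f)
  ∑-concatMap [] g f = refl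
  ∑-concatMap (x ∷ xs) g f = trans (∑-++ (g x) _ f) (cong (∑ (g x) f +_) (∑-concatMap xs g f))

  ∑-swap : ∀ (xs : List A) (ys : List B) (f : A → B → ℕ) →
    ∑ xs (λ x → ∑ ys (f x)) ≡ ∑ ys (λ y → ∑ xs (λ x → f x y))
  ∑-swap [] ys f = sym (∑-0 ys)
  ∑-swap (x ∷ xs) ys f = trans (cong (∑ ys (f x) +_) (∑-swap xs ys f)) (sym (∑-+ ys _ _))

1≤∑⇒∃ : ∀ {A : Set} (xs : List A) {f} → 1 ≤ ∑ xs f → ∃ λ x → x ∈ xs × 1 ≤ f x
1≤∑⇒∃ (x ∷ xs) {f} h with f x in eq
... | suc k = x , here refl , subst (1 ≤_) (sym eq) (s≤s z≤n)
... | zero = let y , m , p = 1≤∑⇒∃ xs h in y , there m , p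

unique-resp-↭ : ∀ {A : Set} {xs ys : List A} → xs ↭ ys → Unique xs → Unique ys
unique-resp-↭ Perm.refl u = u
unique-resp-↭ (prep x p) (a ∷ u) = All-resp-↭ p a ∷ unique-resp-↭ p u
unique-resp-↭ (Perm.swap x y p) ((x≢y ∷ a) ∷ b ∷ u) =
  ((λ e → x≢y (sym e)) ∷ All-resp-↭ p b) ∷ All-resp-↭ p a ∷ unique-resp-↭ p u
unique-resp-↭ (Perm.trans p q) u = unique-resp-↭ q (unique-resp-↭ p u)

unique-++⁻ʳ : ∀ {A : Set} (xs : List A) {ys} → Unique (xs ++ ys) → Unique ys
unique-++⁻ʳ [] u = u
unique-++⁻ʳ (x ∷ xs) (_ ∷ u) = unique-++⁻ʳ xs u

unique-++-disjoint : ∀ {A : Set} {xs ys : List A} {x} → Unique (xs ++ ys) → x ∈ xs → x ∈ ys → ⊥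
unique-++-disjoint {xs = z ∷ xs} (a ∷ u) (here refl) m = All.lookup a (∈-++⁺ʳ xs m) refl
unique-++-disjoint {xs = z ∷ xs} (a ∷ u) (there l) m = unique-++-disjoint u l m

module _ {A B : Set} where

  unique-map : ∀ {xs : List A} {f : A → B} → (∀ {x y} → x ∈ xs → y ∈ xs → f x ≡ f y → x ≡ y) →
    Unique xs → Unique (map f xs)
  unique-map {[]} inj u = []
  unique-map {x ∷ xs} inj (a ∷ u) =
    All.tabulate (λ m e → let z , z∈ , q = ∈-map⁻ _ m in
      All.lookup a z∈ (inj (here refl) (there z∈) (trans e q)))
    ∷ unique-map (λ m n → inj (there m) (there n)) u

  -- The `key` recovers from an element the block it belongs to, so distinct keys make the blocks
  -- disjoint.
  unique-concatMap : ∀ {K : Set} {xs : List A} {g : A → List B} (key : B → K) (key′ : A → K) →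
    AllPairs (λ x y → key′ x ≢ key′ y) xs → (∀ {x} → x ∈ xs → Unique (g x)) →
    (∀ {x y} → x ∈ xs → y ∈ g x → key y ≡ key′ x) → Unique (concatMap g xs)
  unique-concatMap {xs = []} key key′ ps us ks = []
  unique-concatMap {xs = x ∷ xs} {g} key key′ (a ∷ ps) us ks =
    ++⁺ (us (here refl)) (unique-concatMap key key′ ps (λ m → us (there m)) (λ m → ks (there m)))
      λ (m , n) → let z , z∈ , y∈ = find (∈-concatMap⁻ g n) in
        All.lookup a z∈ (trans (sym (ks (here refl) m)) (ks (there z∈) y∈))

-- Menger's theorem for edges

module _ {A : Set} where

  arcs : List A → List (A × A)
  arcs [] = []
  arcs (x ∷ []) = []
  arcs (x ∷ y ∷ p) = (x , y) ∷ arcs (y ∷ p)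

  data Route (T : A → A → Set) : A → A → List A → Set where
    here : ∀ {x} → Route T x x (x ∷ [])
    step : ∀ {x y z p} → T x y → Route T y z p → Route T x z (x ∷ p)

  route-map : ∀ {T T′ x z p} → (∀ {x y} → T x y → T′ x y) → Route T x z p → Route T′ x z p
  route-map s here = here
  route-map s (step t r) = step (s t) (route-map s r)

  arcs-step : ∀ {T y z p} x → Route T y z p → arcs (x ∷ p) ≡ (x , y) ∷ arcs p
  arcs-step x here = refl
  arcs-step x (step _ _) = refl

  route-suffix : ∀ {T y z q x} → Route T y z q → Unique q → x ∈ q →
    ∃ λ q′ → Route T x z q′ × Unique q′ × arcs q′ ⊆ arcs q
  route-suffix here u (here refl) = _ , here , u , λ m → m
  route-suffix (step t r) u (here refl) = _ , step t r , u , λ m → m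
  route-suffix (step {x = w} t r) (_ ∷ u) (there m) =
    let q′ , r′ , u′ , s = route-suffix r u m in
    q′ , r′ , u′ , λ n → subst (_ ∈_) (sym (arcs-step w r)) (there (s n))

  -- Both orientations are excluded: routes consist of arcs, but Menger's theorem is wanted for
  -- undirected edges.
  disjoint : List A → List A → Set
  disjoint p q = ∀ {x y} → (x , y) ∈ arcs p → (x , y) ∉ arcs q × (y , x) ∉ arcs q

module Menger {A : Set} (_≟_ : DecidableEquality A) (H : A → A → Set) (H? : ∀ x y → Dec (H x y))
  (H-sym : ∀ {x y} → H x y → H y x) (vs : List A) (H-target : ∀ {x y} → H x y → y ∈ vs)
  (u v : A) (u≢v : u ≢ v) where

  open import Data.List.Membership.DecPropositional _≟_ using (_∈?_)
  open import Data.List.Membership.DecPropositional (≡-dec _≟_ _≟_) using () renaming (_∈?_ to _∈?ᵃ_)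

  -- If the new vertex already lies on the erased path, the path is restarted from there. The
  -- inclusion of arcs hands edge-disjointness of walks on to the paths.
  loop-erase : ∀ {T : A → A → Set} {x z p} → Route T x z p → ∃ λ q → Route T x z q × Unique q × arcs q ⊆ arcs p
  loop-erase here = _ , here , [] ∷ [] , λ m → m
  loop-erase (step {x} {y} {z} t r) with loop-erase r
  ... | q , rq , uq , s with x ∈? q
  ...   | yes x∈ = let q′ , r′ , u′ , s′ = route-suffix rq uq x∈ in
          q′ , r′ , u′ , λ m → subst (_ ∈_) (sym (arcs-step x r)) (there (s (s′ m)))
  ...   | no x∉ = x ∷ q , step t rq , ¬Any⇒All¬ q x∉ ∷ uq , sub
    where
    sub : arcs (x ∷ q) ⊆ arcs (x ∷ _)
    sub m with subst (_ ∈_) (arcs-step x rq) m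
    ... | here refl = subst (_ ∈_) (sym (arcs-step x r)) (here refl)
    ... | there n = subst (_ ∈_) (sym (arcs-step x r)) (there (s n))

  -- Backward search from v: `fuel` bounds the number of vertices not yet reached.
  search : ∀ {T : A → A → Set} → (∀ x y → Dec (T x y)) → (∀ {x y} → T x y → x ∈ vs) →
    (∃ λ p → Route T u v p) ⊎
    (Σ (A → Bool) λ S → S u ≡ true × S v ≡ false × (∀ {x y} → T x y → S x ≡ true → S y ≡ true))
  search {T} T? T-source = go (length vs) vs (v ∷ []) ≤-refl (λ m → inj₂ m) (here refl)
      (λ { (here refl) → _ , here })
    where
    go : ∀ fuel todo done → length todo ≤ fuel → (∀ {x} → x ∈ vs → x ∈ done ⊎ x ∈ todo) →
      v ∈ done → (∀ {x} → x ∈ done → ∃ λ p → Route T x v p) →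
      (∃ λ p → Route T u v p) ⊎
      (Σ (A → Bool) λ S → S u ≡ true × S v ≡ false × (∀ {x y} → T x y → S x ≡ true → S y ≡ true))
    go fuel todo done fuel≥ cover v∈ routes with u ∈? done
    ... | yes u∈ = inj₁ (routes u∈)
    ... | no u∉ with any? (λ x → any? (T? x) done) todo
    go zero [] done fuel≥ cover v∈ routes | no u∉ | yes ()
    go (suc fuel) todo done fuel≥ cover v∈ routes | no u∉ | yes found
      with x , x∈ , found′ ← find found with y , y∈ , t ← find found′
      with as , bs , refl ← ∈-∃++ x∈ =
      go fuel (as ++ bs) (x ∷ done)
        (s≤s⁻¹ (subst (_≤ suc fuel) (↭-length (shift x as bs)) fuel≥))
        cover′ (there v∈)
        λ { (here refl) → let p , r = routes y∈ in _ , step t r ; (there m) → routes m }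
      where
      cover′ : ∀ {z} → z ∈ vs → z ∈ x ∷ done ⊎ z ∈ as ++ bs
      cover′ m with cover m
      ... | inj₁ n = inj₁ (there n)
      ... | inj₂ n with ∈-resp-↭ (shift x as bs) n
      ...   | here refl = inj₁ (here refl)
      ...   | there k = inj₂ k
    go fuel todo done fuel≥ cover v∈ routes | no u∉ | no none = inj₂
      ( (λ x → does (¬? (x ∈? done))) , dec-true (¬? (u ∈? done)) u∉
      , dec-false (¬? (v ∈? done)) (λ f → f v∈) , closed)
      where
      closed : ∀ {x y} → T x y → does (¬? (x ∈? done)) ≡ true → does (¬? (y ∈? done)) ≡ true
      closed {x} {y} t e with x ∈? done | y ∈? done
      ... | no x∉ | no y∉ = refl
      ... | no x∉ | yes y∈ with cover (T-source t)
      ...   | inj₁ m = contradiction m x∉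
      ...   | inj₂ m = contradiction (lose m (lose y∈ t)) none

  δ : A → A → ℕ
  δ w x = ⟦ does (x ≟ w) ⟧

  δ-refl : ∀ w → δ w w ≡ 1
  δ-refl w = cong ⟦_⟧ (dec-true (w ≟ w) refl)

  δ-≢ : ∀ {w x} → x ≢ w → δ w x ≡ 0
  δ-≢ {w} {x} ne = cong ⟦_⟧ (dec-false (x ≟ w) ne)

  -- With `f` the indicator of a vertex this is Kirchhoff's law there; with `f` the indicator of a
  -- set it gives the net flow across the cut.
  Balanced : ℕ → A → List (A × A) → Set
  Balanced j w L = ∀ (f : A → ℕ) →
    ∑ L (λ a → f (proj₁ a)) + (j * f v + f w) ≡ ∑ L (λ a → f (proj₂ a)) + (j * f u + f u)

  -- j units flow from u to v and one more unit from u to w; conservation is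
  -- tested against all potentials f, which avoids indexing by vertices.
  record Flow (j : ℕ) (w : A) (L : List (A × A)) : Set where
    field
      unique : Unique L
      valid : ∀ {x y} → (x , y) ∈ L → H x y
      anti : ∀ {x y} → (x , y) ∈ L → (y , x) ∉ L
      balanced : Balanced j w L
  open Flow

  -- An edge has capacity one in total, and `L` never holds both of its orientations. Hence an arc
  -- outside `L` is either free or the reverse of an arc in use.
  Residual : List (A × A) → A → A → Set
  Residual L x y = H x y × (x , y) ∉ L

  -- The last component says that new arcs appear only at `x`. A residual path that never returns to
  -- `x` therefore stays residual.
  push : ∀ {j x y L} → x ≢ y → Flow j x L → Residual L x y →
    ∃ λ L′ → Flow j y L′ × (∀ {a b} → a ≢ x → b ≢ x → (a , b) ∈ L′ → (a , b) ∈ L)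
  push {j} {x} {y} {L} x≢y F (h , xy∉) with (y , x) ∈?ᵃ L
  ... | no yx∉ = (x , y) ∷ L , record
      { unique = ¬Any⇒All¬ L xy∉ ∷ unique F
      ; valid = λ { (here refl) → h ; (there m) → valid F m }
      ; anti = λ { (here refl) (here e) → x≢y (cong proj₂ e)
                 ; (here refl) (there m) → yx∉ m
                 ; (there m) (here refl) → yx∉ m
                 ; (there m) (there n) → anti F m n }
      ; balanced = λ f → +-cancelʳ-≡ (f x) _ _
          (trans (left (f x) (∑ L _) (j * f v) (f y))
          (trans (cong (f x + f y +_) (balanced F f)) (right (f x) (f y) _ _))) }
    , λ { a≢x b≢x (here refl) → contradiction refl a≢x ; a≢x b≢x (there m) → m }
    where
    left : ∀ a s t b → a + s + (t + b) + a ≡ a + b + (s + (t + a))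
    left = solve-∀
    right : ∀ a b s t → a + b + (s + t) ≡ b + s + t + a
    right = solve-∀
  -- The edge carries flow from `y` to `x`; moving the unit from `x` to `y` cancels that flow.
  ... | yes yx∈ with as , bs , refl ← ∈-∃++ yx∈ = as ++ bs , record
      { unique = uniq′ u′
      ; valid = λ m → valid F (back m)
      ; anti = λ m n → anti F (back m) (back n)
      ; balanced = λ f → +-cancelˡ-≡ (f x) _ _
          (trans (left (f x) (∑ (as ++ bs) _) (j * f v) (f y))
          (trans (cong (_+ (j * f v + f x)) (sym (∑-↭ _ p)))
          (trans (balanced F f)
          (trans (cong (_+ (j * f u + f u)) (∑-↭ _ p)) (+-assoc (f x) _ _))))) }
    , λ _ _ m → back m
    where
    p = shift (y , x) as bs
    u′ = unique-resp-↭ p (unique F)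
    uniq′ : ∀ {a : A × A} {l} → Unique (a ∷ l) → Unique l
    uniq′ (_ ∷ q) = q
    back : ∀ {a} → a ∈ as ++ bs → a ∈ as ++ (y , x) ∷ bs
    back m = ∈-resp-↭ (↭-sym p) (there m)
    left : ∀ a s t b → a + (s + (t + b)) ≡ b + s + (t + a)
    left = solve-∀

  -- This is why augmenting paths are taken simple: the rest of the path avoids the only vertex at
  -- which arcs were added.
  residual-map : ∀ {L L′ y p} {x} → (∀ {a b} → a ≢ x → b ≢ x → (a , b) ∈ L′ → (a , b) ∈ L) →
    All (x ≢_) p → Route (Residual L) y v p → Route (Residual L′) y v p
  residual-map s _ here = here
  residual-map s (x≢y ∷ a@(_ ∷ _)) (step (h , n) r@here) =
    step (h , λ m → n (s (λ e → x≢y (sym e)) (λ e → All.head a (sym e)) m)) (residual-map s a r)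
  residual-map s (x≢y ∷ a@(_ ∷ _)) (step (h , n) r@(step _ _)) =
    step (h , λ m → n (s (λ e → x≢y (sym e)) (λ e → All.head a (sym e)) m)) (residual-map s a r)

  head-∈ : ∀ {T : A → A → Set} {x z p} → Route T x z p → x ∈ p
  head-∈ here = here refl
  head-∈ (step _ _) = here refl

  augment : ∀ {j x L p} → Flow j x L → Route (Residual L) x v p → Unique p → ∃ λ L′ → Flow j v L′
  augment F here _ = _ , F
  augment F (step t r) (a ∷ uq) =
    let L′ , F′ , s = push (All.lookup a (head-∈ r)) F t in
    augment F′ (residual-map s a r) uq

  Cut : ℕ → Set
  Cut k = ∀ (S : A → Bool) → S u ≡ true → S v ≡ false →
    ∃ λ C → Unique C × (∀ {x y} → (x , y) ∈ C → H x y × S x ≡ true × S y ≡ false) × k ≤ length C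

  -- The equality case of max-flow and min-cut. As no residual arc leaves `S`, every arc of `H` that
  -- leaves `S` carries flow and no flow enters `S`; conservation tested with the indicator of `S`
  -- bounds the outgoing flow by `j`.
  saturated : ∀ {j k L} → Flow j u L → Cut k → (S : A → Bool) → S u ≡ true → S v ≡ false →
    (∀ {x y} → Residual L x y → S x ≡ true → S y ≡ true) → k ≤ j
  saturated {j} {k} {L} F cut S Su Sv closed with cut S Su Sv
  ... | C , uC , C-cut , k≤ = ≤-trans k≤ (≤-trans C≤out out≤j)
    where
    out : A × A → ℕ
    out (x , y) = ⟦ S x ∧ not (S y) ⟧
    C⊆L : C ⊆ L
    C⊆L {x , y} m with (x , y) ∈?ᵃ L
    ... | yes l = l
    ... | no ¬l = let h , Sx , Sy = C-cut m in
          contradiction (trans (sym (closed (h , ¬l) Sx)) Sy) λ ()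
    out≡1 : ∀ {a} → a ∈ C → 1 ≡ out a
    out≡1 {x , y} m with C-cut m
    ... | _ , Sx , Sy rewrite Sx | Sy = refl
    C≤out : length C ≤ ∑ L out
    C≤out = begin
      length C      ≡⟨ ∑-1 C ⟨
      ∑ C (λ _ → 1) ≡⟨ ∑-cong∈ C out≡1 ⟩
      ∑ C out       ≤⟨ ∑-⊆ out uC C⊆L ⟩
      ∑ L out       ∎
      where open ≤-Reasoning
    pointwise : ∀ {a} → a ∈ L → ⟦ S (proj₂ a) ⟧ + out a ≤ ⟦ S (proj₁ a) ⟧
    pointwise {x , y} m with S x in Sx | S y in Sy
    ... | true | true = ≤-refl
    ... | true | false = ≤-refl
    ... | false | false = ≤-refl
    -- By `anti`, the reverse of a flow arc that enters `S` would be a residual arc leaving `S`.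
    ... | false | true = contradiction
          (trans (sym (closed (H-sym (valid F m) , anti F m) Sy)) Sx) λ ()
    src tgt : ℕ
    src = ∑ L (λ a → ⟦ S (proj₁ a) ⟧)
    tgt = ∑ L (λ a → ⟦ S (proj₂ a) ⟧)
    src≡tgt+j : src ≡ tgt + j
    src≡tgt+j = +-cancelʳ-≡ 1 _ _ (trans (left src j) (trans
      (subst₂ (λ a b → src + (j * ⟦ a ⟧ + ⟦ b ⟧) ≡ tgt + (j * ⟦ b ⟧ + ⟦ b ⟧)) Sv Su (balanced F (λ x → ⟦ S x ⟧)))
      (right tgt j)))
      where
      left : ∀ s j → s + 1 ≡ s + (j * 0 + 1)
      left = solve-∀
      right : ∀ t j → t + (j * 1 + 1) ≡ t + j + 1
      right = solve-∀
    out≤j : ∑ L out ≤ j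
    out≤j = linear 0 (subst (_≤ src) (∑-+ L _ out) (∑-mono∈ L pointwise))
      (trans (cong (λ s → ∑ L out + s + 0) src≡tgt+j) (identity (∑ L out) tgt j))
      where
      identity : ∀ o t j → o + (t + j) + 0 ≡ j + (t + o)
      identity = solve-∀

  emptyFlow : Flow 0 u []
  emptyFlow = record { unique = [] ; valid = λ () ; anti = λ () ; balanced = λ f → refl }

  -- The pending unit has arrived at `v` and counts as finished; the next one waits at `u`.
  completeUnit : ∀ {j L} → Flow j v L → Flow (suc j) u L
  completeUnit {j} {L} F = record
    { unique = unique F ; valid = valid F ; anti = anti F
    ; balanced = λ f → trans (left (∑ L _) j (f v) (f u))
        (trans (cong (_+ f u) (balanced F f)) (right (∑ L _) j (f u))) }
    where
    left : ∀ s j a b → s + (suc j * a + b) ≡ s + (j * a + a) + b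
    left = solve-∀
    right : ∀ s j b → s + (j * b + b) + b ≡ s + (suc j * b + b)
    right = solve-∀

  maxFlow : ∀ {k} → Cut k → ∀ j → j ≤ k → ∃ λ L → Flow j u L
  maxFlow cut zero _ = [] , emptyFlow
  maxFlow cut (suc j) j<k with maxFlow cut j (<⇒≤ j<k)
  ... | L , F with search {Residual L} (λ x y → H? x y ×-dec ¬? ((x , y) ∈?ᵃ L))
                     (λ t → H-target (H-sym (proj₁ t)))
  ...   | inj₂ (S , Su , Sv , closed) = contradiction j<k (≤⇒≯ (saturated F cut S Su Sv closed))
  ...   | inj₁ (_ , r) = let p , r′ , up , _ = loop-erase r
                             L′ , F′ = augment F r′ up in
                         L′ , completeUnit F′

  -- Conservation once the arcs of a walk from `u` to `w` have been removed: `j` units still start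
  -- at `u`, one starts at `w`, and all of them end at `v`.
  Trace : ℕ → A → List (A × A) → Set
  Trace j w L = ∀ (f : A → ℕ) →
    ∑ L (λ a → f (proj₁ a)) + (j * f v + f v) ≡ ∑ L (λ a → f (proj₂ a)) + (j * f u + f w)

  -- While the unit is at w ≢ v, testing with the indicator of w yields an arc leaving w.
  trace : ∀ {j} n L w → length L ≤ n → Trace j w L →
    ∃ λ p → ∃ λ L′ → Route (λ x y → (x , y) ∈ L) w v p × L ↭ arcs p ++ L′ × Trace j v L′
  trace {j} n L w n≥ bal with w ≟ v
  ... | yes refl = w ∷ [] , L , here , ↭-refl , bal
  ... | no w≢v with 1≤∑⇒∃ L {λ a → δ w (proj₁ a)} leaving
    where
    open ≤-Reasoning
    leaving : 1 ≤ ∑ L (λ a → δ w (proj₁ a))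
    leaving = begin
      1 ≤⟨ m≤n+m 1 _ ⟩
      (∑ L (λ a → δ w (proj₂ a)) + j * δ w u) + 1 ≡⟨ cong (∑ L (λ a → δ w (proj₂ a)) + j * δ w u +_) (δ-refl w) ⟨
      (∑ L (λ a → δ w (proj₂ a)) + j * δ w u) + δ w w ≡⟨ +-assoc (∑ L (λ a → δ w (proj₂ a))) (j * δ w u) _ ⟩
      ∑ L (λ a → δ w (proj₂ a)) + (j * δ w u + δ w w) ≡⟨ bal (δ w) ⟨
      ∑ L (λ a → δ w (proj₁ a)) + (j * δ w v + δ w v)
        ≡⟨ cong (λ e → ∑ L (λ a → δ w (proj₁ a)) + (j * e + e)) (δ-≢ (λ e → w≢v (sym e))) ⟩
      ∑ L (λ a → δ w (proj₁ a)) + (j * 0 + 0) ≡⟨ vanish _ j ⟩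
      ∑ L (λ a → δ w (proj₁ a)) ∎
      where
      vanish : ∀ s j → s + (j * 0 + 0) ≡ s
      vanish = solve-∀
  trace {j} zero [] w n≥ bal | no w≢v | (_ , () , _)
  trace {j} (suc n) L w n≥ bal | no w≢v | (x , y) , m , pos with x ≟ w
  ... | yes refl with as , bs , refl ← ∈-∃++ m =
    let L₁ = as ++ bs
        σ = shift (w , y) as bs
        p , L′ , r , π , bal′ = trace {j} n L₁ y (s≤s⁻¹ (subst (_≤ suc n) (↭-length σ) n≥)) (bal₁ σ)
    in w ∷ p , L′ , step m (route-map (λ k → ∈-resp-↭ (↭-sym σ) (there k)) r)
       , ↭-trans σ (subst (λ l → _ ↭ l ++ L′) (sym (arcs-step w r)) (prep (w , y) π)) , bal′
    where
    bal₁ : as ++ (w , y) ∷ bs ↭ (w , y) ∷ as ++ bs → Trace j y (as ++ bs)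
    bal₁ σ f = +-cancelˡ-≡ (f w) _ _ (begin
      f w + (∑ (as ++ bs) _ + (j * f v + f v)) ≡⟨ +-assoc (f w) _ _ ⟨
      f w + ∑ (as ++ bs) _ + (j * f v + f v)   ≡⟨ cong (_+ _) (∑-↭ _ σ) ⟨
      ∑ (as ++ (w , y) ∷ bs) _ + (j * f v + f v) ≡⟨ bal f ⟩
      ∑ (as ++ (w , y) ∷ bs) _ + (j * f u + f w) ≡⟨ cong (_+ _) (∑-↭ _ σ) ⟩
      f y + ∑ (as ++ bs) _ + (j * f u + f w) ≡⟨ right (f y) (∑ (as ++ bs) _) (j * f u) (f w) ⟩
      f w + (∑ (as ++ bs) _ + (j * f u + f y)) ∎)
      where
      open ≡-Reasoning
      right : ∀ a s t b → a + s + (t + b) ≡ b + (s + (t + a))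
      right = solve-∀
  trace (suc n) L w n≥ bal | no w≢v | (x , y) , m , () | no _

  -- Tracing one walk out of the flow leaves a flow of one unit less. Walks share no arc because the
  -- list is used up without repetition, and no edge is used in opposite directions because of
  -- `anti`.
  decompose : ∀ j {L} → Unique L → (∀ {x y} → (x , y) ∈ L → H x y) → (∀ {x y} → (x , y) ∈ L → (y , x) ∉ L) →
    Balanced j u L →
    ∃ λ ps → length ps ≡ j × All (λ p → Route H u v p × Unique p × arcs p ⊆ L) ps × AllPairs disjoint ps
  decompose zero _ _ _ _ = [] , refl , [] , []
  decompose (suc j) {L} uL valid anti bal =
    let p , L′ , r , π , bal′ = trace {j} (length L) L u ≤-refl (λ f → trace-start f)
        q , rq , uq , q⊆p = loop-erase r
        L′⊆L : L′ ⊆ L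
        L′⊆L = λ m → ∈-resp-↭ (↭-sym π) (∈-++⁺ʳ (arcs p) m)
        p⊆L : arcs p ⊆ L
        p⊆L = λ m → ∈-resp-↭ (↭-sym π) (∈-++⁺ˡ m)
        uπ = unique-resp-↭ π uL
        ps , len , allp , dis = decompose j (unique-++⁻ʳ (arcs p) uπ) (λ m → valid (L′⊆L m))
          (λ m n → anti (L′⊆L m) (L′⊆L n)) (unit L′ bal′)
    in q ∷ ps , cong suc len
       , (route-map valid rq , uq , λ m → p⊆L (q⊆p m)) ∷ All.map {Q = λ p → Route H u v p × Unique p × arcs p ⊆ L} (λ (r , u , s) → r , u , λ m → L′⊆L (s m)) allp
       , All.map {Q = disjoint q} (λ (_ , _ , s) m →
           (λ n → unique-++-disjoint uπ (q⊆p m) (s n)) ,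
           (λ n → anti (p⊆L (q⊆p m)) (L′⊆L (s n)))) allp ∷ dis
    where
    trace-start : Trace j u L
    trace-start f = +-cancelʳ-≡ (f u) _ _ (trans (left (∑ L _) j (f v) (f u))
      (trans (bal f) (right (∑ L _) j (f u))))
      where
      left : ∀ s j a b → s + (j * a + a) + b ≡ s + (suc j * a + b)
      left = solve-∀
      right : ∀ s j b → s + (suc j * b + b) ≡ s + (j * b + b) + b
      right = solve-∀
    unit : ∀ L′ → Trace j v L′ → Balanced j u L′
    unit L′ e f = +-cancelʳ-≡ (f v) _ _ (trans (rotate (∑ L′ _) (j * f v) (f u) (f v))
      (trans (cong (_+ f u) (e f)) (rotate (∑ L′ _) (j * f u) (f v) (f u))))
      where
      rotate : ∀ s t a b → s + (t + a) + b ≡ s + (t + b) + a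
      rotate = solve-∀

  menger : ∀ {k} → Cut k →
    ∃ λ ps → length ps ≡ k × All (λ p → Route H u v p × Unique p) ps × AllPairs disjoint ps
  menger {k} cut =
    let L , F = maxFlow cut k ≤-refl
        ps , len , allp , dis = decompose k (unique F) (valid F) (anti F) (balanced F)
    in ps , len , All.map (λ (r , u , _) → r , u) allp , dis

-- Words, transpositions and parity

module _ {X : Set} where

  -- Agrees definitionally with `swap` on `V n`, but allows words shorter than the alphabet, as they
  -- occur inside a copy.
  swapAt : ∀ {n} → Vec X n → Fin n → Fin n → Vec X n
  swapAt x i j = (x [ i ]≔ lookup x j) [ j ]≔ lookup x i

  lookup-swapAtʳ : ∀ {n} (x : Vec X n) i j → lookup (swapAt x i j) j ≡ lookup x i
  lookup-swapAtʳ x i j = lookup∘update j (x [ i ]≔ lookup x j) _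

  lookup-swapAtˡ : ∀ {n} (x : Vec X n) i j → lookup (swapAt x i j) i ≡ lookup x j
  lookup-swapAtˡ x i j with i Fin.≟ j
  ... | yes refl = lookup∘update i (x [ i ]≔ lookup x i) _
  ... | no i≢j = trans (lookup∘update′ i≢j (x [ i ]≔ lookup x j) _) (lookup∘update i x _)

  lookup-swapAt-other : ∀ {n} (x : Vec X n) {i j k} → k ≢ i → k ≢ j → lookup (swapAt x i j) k ≡ lookup x k
  lookup-swapAt-other x {i} {j} k≢i k≢j =
    trans (lookup∘update′ k≢j (x [ i ]≔ lookup x j) _) (lookup∘update′ k≢i x _)

  vec-ext : ∀ {n} {x y : Vec X n} → (∀ k → lookup x k ≡ lookup y k) → x ≡ y
  vec-ext {x = x} {y} e = trans (sym (tabulate∘lookup x)) (trans (tabulate-cong e) (tabulate∘lookup y))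

  swapAt-involutive : ∀ {n} (x : Vec X n) i j → swapAt (swapAt x i j) i j ≡ x
  swapAt-involutive x i j = vec-ext λ k → at k
    where
    at : ∀ k → lookup (swapAt (swapAt x i j) i j) k ≡ lookup x k
    at k with k Fin.≟ i | k Fin.≟ j
    ... | yes refl | _ = trans (lookup-swapAtˡ (swapAt x i j) i j) (lookup-swapAtʳ x i j)
    ... | no _ | yes refl = trans (lookup-swapAtʳ (swapAt x i j) i j) (lookup-swapAtˡ x i j)
    ... | no k≢i | no k≢j = trans (lookup-swapAt-other (swapAt x i j) k≢i k≢j) (lookup-swapAt-other x k≢i k≢j)

  Distinct : ∀ {n} → Vec X n → Set
  Distinct x = ∀ i j → lookup x i ≡ lookup x j → i ≡ j

  lookup-∈ : ∀ {n} (x : Vec X n) i → lookup x i ∈ toList x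
  lookup-∈ (a ∷ x) zero = here refl
  lookup-∈ (a ∷ x) (suc i) = there (lookup-∈ x i)

  ∈-lookup⁻ : ∀ {n} (x : Vec X n) {a} → a ∈ toList x → ∃ λ i → a ≡ lookup x i
  ∈-lookup⁻ (b ∷ x) (here e) = zero , e
  ∈-lookup⁻ (b ∷ x) (there m) = let i , e = ∈-lookup⁻ x m in suc i , e

  unique⇒distinct : ∀ {n} {x : Vec X n} → Unique (toList x) → Distinct x
  unique⇒distinct {x = a ∷ x} (p ∷ u) zero zero e = refl
  unique⇒distinct {x = a ∷ x} (p ∷ u) zero (suc j) e = contradiction e (All.lookup p (lookup-∈ x j))
  unique⇒distinct {x = a ∷ x} (p ∷ u) (suc i) zero e = contradiction (sym e) (All.lookup p (lookup-∈ x i))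
  unique⇒distinct {x = a ∷ x} (p ∷ u) (suc i) (suc j) e = cong suc (unique⇒distinct u i j e)

  distinct⇒unique : ∀ {n} {x : Vec X n} → Distinct x → Unique (toList x)
  distinct⇒unique {x = []} d = []
  distinct⇒unique {x = a ∷ x} d =
    All.tabulate (λ m e → let i , q = ∈-lookup⁻ x m in contradiction (d zero (suc i) (trans e q)) λ ())
    ∷ distinct⇒unique (λ i j e → FinP.suc-injective (d (suc i) (suc j) e))

  swapAt-injective : ∀ {n} (x : Vec X n) → Distinct x → ∀ {i j k l} → toℕ i < toℕ j → toℕ k < toℕ l →
    swapAt x i j ≡ swapAt x k l → (i , j) ≡ (k , l)
  swapAt-injective x d {i} {j} {k} {l} i<j k<l e with i Fin.≟ k | i Fin.≟ l
  ... | yes refl | _ = cong (i ,_) (d j l (trans (sym (lookup-swapAtˡ x i j))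
          (trans (cong (λ y → lookup y i) e) (lookup-swapAtˡ x i l))))
  ... | no i≢k | yes refl = contradiction
          (subst (λ z → toℕ i < toℕ z) (d j k (trans (sym (lookup-swapAtˡ x i j))
             (trans (cong (λ y → lookup y i) e) (lookup-swapAtʳ x k i)))) i<j)
          (<⇒≯ k<l)
  ... | no i≢k | no i≢l = contradiction
          (d j i (trans (sym (lookup-swapAtˡ x i j))
             (trans (cong (λ y → lookup y i) e) (lookup-swapAt-other x i≢k i≢l))))
          (λ q → <-irrefl (cong toℕ (sym q)) i<j)

  -- x ~ y: an odd number of adjacent transpositions leads from x to y.
  data _~_ : ∀ {n} → Vec X n → Vec X n → Set where
    top : ∀ {n a b} {x : Vec X n} → (a ∷ b ∷ x) ~ (b ∷ a ∷ x)
    under : ∀ {n a} {x y : Vec X n} → x ~ y → (a ∷ x) ~ (a ∷ y)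
    three : ∀ {n} {x y z t : Vec X n} → x ~ y → y ~ z → z ~ t → x ~ t

  -- Every transposition is odd: the one of positions 0 and k + 2 is conjugate under the swap of
  -- positions 0 and 1 to one that lies a level deeper.
  ~-swapAt : ∀ {n} (x : Vec X n) i j → toℕ i < toℕ j → x ~ swapAt x i j
  ~-swapAt (a ∷ b ∷ x) zero (suc zero) _ = top
  ~-swapAt (a ∷ b ∷ x) zero (suc (suc k)) _ = three top (under (~-swapAt (a ∷ x) zero (suc k) (s≤s z≤n))) top
  ~-swapAt (a ∷ x) (suc i) (suc j) (s≤s i<j) = under (~-swapAt x i j i<j)

  ~⇒↭ : ∀ {n} {x y : Vec X n} → x ~ y → toList x ↭ toList y
  ~⇒↭ top = Perm.swap _ _ ↭-refl
  ~⇒↭ (under p) = prep _ (~⇒↭ p)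
  ~⇒↭ (three p q r) = ↭-trans (~⇒↭ p) (↭-trans (~⇒↭ q) (~⇒↭ r))

  ~-unique : ∀ {n} {x y : Vec X n} → x ~ y → Unique (toList x) → Unique (toList y)
  ~-unique p = unique-resp-↭ (~⇒↭ p)

module _ {m : ℕ} where

  smallerThan : ∀ {n} → Fin m → Vec (Fin m) n → Bool
  smallerThan a [] = false
  smallerThan a (b ∷ x) = does (b FinP.<? a) xor smallerThan a x

  -- The number of inversions modulo 2, summed from the parities `smallerThan`. It is the
  -- bipartition of `BS_n`.
  parity : ∀ {n} → Vec (Fin m) n → Bool
  parity [] = false
  parity (a ∷ x) = smallerThan a x xor parity x

  smallerThan-~ : ∀ {n} {x y : Vec (Fin m) n} c → x ~ y → smallerThan c x ≡ smallerThan c y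
  smallerThan-~ c (top {a = a} {b} {x}) = xor-exchange (does (a FinP.<? c)) (does (b FinP.<? c)) (smallerThan c x)
    where
    xor-exchange : ∀ p q r → p xor (q xor r) ≡ q xor (p xor r)
    xor-exchange true true r = refl
    xor-exchange true false r = refl
    xor-exchange false true r = refl
    xor-exchange false false r = refl
  smallerThan-~ c (under {a = a} p) = cong (does (a FinP.<? c) xor_) (smallerThan-~ c p)
  smallerThan-~ c (three p q r) = trans (smallerThan-~ c p) (trans (smallerThan-~ c q) (smallerThan-~ c r))

  <?-flip : ∀ {a b : Fin m} → a ≢ b → does (b FinP.<? a) ≡ not (does (a FinP.<? b))
  <?-flip {a} {b} a≢b with FinP.<-cmp a b
  ... | tri< a<b _ b≮a = trans (dec-false (b FinP.<? a) b≮a) (cong not (sym (dec-true (a FinP.<? b) a<b)))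
  ... | tri≈ _ e _ = contradiction e a≢b
  ... | tri> a≮b _ b<a = trans (dec-true (b FinP.<? a) b<a) (cong not (sym (dec-false (a FinP.<? b) a≮b)))

  parity-~ : ∀ {n} {x y : Vec (Fin m) n} → Unique (toList x) → x ~ y → parity y ≡ not (parity x)
  parity-~ ((a≢b ∷ _) ∷ _) (top {a = a} {b} {x}) rewrite <?-flip a≢b =
    identity (does (a FinP.<? b)) (smallerThan a x) (smallerThan b x) (parity x)
    where
    identity : ∀ l c d p → (l xor d) xor (c xor p) ≡ not ((not l xor c) xor (d xor p))
    identity true true true true = refl
    identity true true true false = refl
    identity true true false true = refl
    identity true true false false = refl
    identity true false true true = refl
    identity true false true false = refl
    identity true false false true = refl
    identity true false false false = refl
    identity false true true true = refl
    identity false true true false = refl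
    identity false true false true = refl
    identity false true false false = refl
    identity false false true true = refl
    identity false false true false = refl
    identity false false false true = refl
    identity false false false false = refl
  parity-~ (_ ∷ u) (under {a = a} {x} p) rewrite sym (smallerThan-~ a p) | parity-~ u p =
    xor-not (smallerThan a x) (parity x)
    where
    xor-not : ∀ p q → p xor not q ≡ not (p xor q)
    xor-not true true = refl
    xor-not true false = refl
    xor-not false q = refl
  parity-~ u (three {x = x} p q r)
    rewrite parity-~ (~-unique q (~-unique p u)) r | parity-~ (~-unique p u) q | parity-~ u p = not-thrice (parity x)
    where
    not-thrice : ∀ b → not (not (not b)) ≡ not b
    not-thrice true = refl
    not-thrice false = refl

-- The generating transpositions with positions counted from the end of a
-- word, so that deleting the head turns BS_n into BS_{n-1}.
generators : (n : ℕ) → List (Fin n × Fin n)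
generators 0 = []
generators 1 = []
generators 2 = (zero , suc zero) ∷ []
generators (suc (suc (suc n))) =
  (zero , suc zero) ∷ (zero , fromℕ (suc (suc n))) ∷
  map (λ (i , j) → suc i , suc j) (generators (suc (suc n)))

generators-< : ∀ n {i j} → (i , j) ∈ generators n → toℕ i < toℕ j
generators-< 2 (here refl) = s≤s z≤n
generators-< (suc (suc (suc n))) (here refl) = s≤s z≤n
generators-< (suc (suc (suc n))) (there (here refl)) = s≤s z≤n
generators-< (suc (suc (suc n))) (there (there m)) with ∈-map⁻ _ m
... | _ , g , refl = s≤s (generators-< (suc (suc n)) g)

generators-unique : ∀ n → Unique (generators n)
generators-unique 0 = []
generators-unique 1 = []
generators-unique 2 = [] ∷ []
generators-unique (suc (suc (suc n))) =
  ((λ ()) ∷ All.tabulate (λ m e → zero≢ m (cong proj₁ e))) ∷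
  All.tabulate (λ m e → zero≢ m (cong proj₁ e)) ∷
  map⁺ (λ { refl → refl }) (generators-unique (suc (suc n)))
  where
  zero≢ : ∀ {g} → g ∈ map (λ (i , j) → suc i , suc j) (generators (suc (suc n))) → zero ≢ proj₁ g
  zero≢ m e with ∈-map⁻ _ m
  zero≢ m () | _ , _ , refl

length-generators : ∀ n → length (generators (2 + n)) ≡ 1 + 2 * n
length-generators zero = refl
length-generators (suc n) = cong (2 +_) (trans (length-map _ (generators (2 + n)))
  (trans (length-generators n) (sym (+-suc n (n + 0)))))

-- Bipartite counting and the recursive structure of permutations

⟦⟧-split : ∀ s c → ⟦ s ⟧ ≡ ⟦ s ∧ c ⟧ + ⟦ s ∧ not c ⟧
⟦⟧-split true true = refl
⟦⟧-split true false = refl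
⟦⟧-split false c = refl

module _ {A : Set} where

  -- A member of `S` of one colour has its neighbours in `S` among the members of the other colour.
  -- With class sizes p and q this leaves at most pq + qp ordered adjacent pairs. The generality of
  -- `nb` covers both `BS_n` and the faulty graph.
  bipartite-bound : (colour S : A → Bool) (vs : List A) (nb : A → List A) →
    (∀ {x} → x ∈ vs → Unique (nb x)) → (∀ {x} → x ∈ vs → nb x ⊆ vs) →
    (∀ {x y} → x ∈ vs → y ∈ nb x → colour y ≡ not (colour x)) →
    ∑ vs (λ x → ⟦ S x ⟧ * ∑ (nb x) (λ y → ⟦ S y ⟧)) ≤
    2 * (∑ vs (λ x → ⟦ S x ∧ colour x ⟧) * ∑ vs (λ x → ⟦ S x ∧ not (colour x) ⟧))
  bipartite-bound colour S vs nb nb-unique nb⊆ alternates = begin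
    ∑ vs (λ x → ⟦ S x ⟧ * ∑ (nb x) (λ y → ⟦ S y ⟧))                   ≤⟨ ∑-mono∈ vs pointwise ⟩
    ∑ vs (λ x → ⟦ S x ∧ colour x ⟧ * q + ⟦ S x ∧ not (colour x) ⟧ * p) ≡⟨ ∑-+ vs _ _ ⟩
    _                                                                 ≡⟨ cong₂ _+_ (∑-*ʳ vs q _) (∑-*ʳ vs p _) ⟩
    p * q + q * p                                                     ≡⟨ identity p q ⟩
    2 * (p * q)                                                       ∎
    where
    open ≤-Reasoning
    p = ∑ vs (λ x → ⟦ S x ∧ colour x ⟧)
    q = ∑ vs (λ x → ⟦ S x ∧ not (colour x) ⟧)
    identity : ∀ p q → p * q + q * p ≡ 2 * (p * q)
    identity = solve-∀
    colour-count : ∀ {x} → x ∈ vs → ∀ (f : Bool → Bool) → f (not (colour x)) ≡ true →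
      ∑ (nb x) (λ y → ⟦ S y ⟧) ≤ ∑ vs (λ y → ⟦ S y ∧ f (colour y) ⟧)
    colour-count {x} m f e = ≤-trans
      (≤-reflexive (∑-cong∈ (nb x) (λ {y} n → cong ⟦_⟧ (keep (S y)
        (trans (cong f (alternates m n)) e)))))
      (∑-⊆ _ (nb-unique m) (nb⊆ m))
      where
      keep : ∀ s {b} → b ≡ true → s ≡ s ∧ b
      keep true refl = refl
      keep false _ = refl
    pointwise : ∀ {x} → x ∈ vs → ⟦ S x ⟧ * ∑ (nb x) (λ y → ⟦ S y ⟧) ≤
      ⟦ S x ∧ colour x ⟧ * q + ⟦ S x ∧ not (colour x) ⟧ * p
    pointwise {x} m with S x | colour x in e
    ... | false | _ = z≤n
    ... | true | true rewrite +-identityʳ (∑ (nb x) (λ y → ⟦ S y ⟧)) | +-identityʳ q | +-identityʳ q =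
          colour-count m not (trans (not-involutive (colour x)) e)
    ... | true | false rewrite +-identityʳ (∑ (nb x) (λ y → ⟦ S y ⟧)) | +-identityʳ p =
          colour-count m (λ b → b) (cong not e)

  module _ {K : Set} (_≟_ : DecidableEquality K) (key : A → K) where

    only except : K → (A → ℕ) → A → ℕ
    only a f x = if does (key x ≟ a) then f x else 0
    except a f x = if does (key x ≟ a) then 0 else f x

    only-+-except : ∀ a f x → f x ≡ only a f x + except a f x
    only-+-except a f x with does (key x ≟ a)
    ... | true = sym (+-identityʳ (f x))
    ... | false = refl

    ∑-only : ∀ {xs x} f → AllPairs (λ x y → key x ≢ key y) xs → x ∈ xs → ∑ xs (only (key x) f) ≡ f x
    ∑-only {x ∷ xs} f (p ∷ ps) (here refl) rewrite dec-true (key x ≟ key x) refl =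
      trans (cong (f x +_) (trans (∑-cong∈ xs (λ {y} m → cong (if_then f y else 0)
        (dec-false (key y ≟ key x) (λ e → All.lookup p m (sym e))))) (∑-0 xs))) (+-identityʳ (f x))
    ∑-only {z ∷ xs} {x} f (p ∷ ps) (there m) rewrite dec-false (key z ≟ key x) (All.lookup p m) = ∑-only f ps m

    ∑-pick : ∀ {xs x} f → AllPairs (λ x y → key x ≢ key y) xs → x ∈ xs →
      ∑ xs f ≡ f x + ∑ xs (except (key x) f)
    ∑-pick {xs} {x} f ps m = trans (∑-cong xs (only-+-except (key x) f))
      (trans (∑-+ xs _ _) (cong (_+ ∑ xs (except (key x) f)) (∑-only f ps m)))

module _ {X : Set} where

  select : ∀ {n} → Vec X (suc n) → List (X × Vec X n)
  select {zero} (a ∷ []) = (a , []) ∷ []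
  select {suc n} (a ∷ as) = (a , as) ∷ map (λ (b , r) → b , a ∷ r) (select as)

  -- The list is laid out by first letter: each block `startingWith` is one copy of the next smaller
  -- graph, and `select` lists the copies.
  perms : ∀ {n} → Vec X n → List (Vec X n)
  startingWith : ∀ {n} → X × Vec X n → List (Vec X (suc n))
  perms {zero} [] = [] ∷ []
  perms {suc n} as = concatMap startingWith (select as)
  startingWith (a , r) = map (a ∷_) (perms r)

  ∑-perms : ∀ {n} (as : Vec X (suc n)) f →
    ∑ (perms as) f ≡ ∑ (select as) (λ (a , r) → ∑ (perms r) (λ x → f (a ∷ x)))
  ∑-perms as f = trans (∑-concatMap (select as) _ f) (∑-cong (select as) (λ (a , r) → ∑-map (perms r) (a ∷_) f))

  select-keys : ∀ {n} (as : Vec X (suc n)) → map proj₁ (select as) ≡ toList as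
  select-keys {zero} (a ∷ []) = refl
  select-keys {suc n} (a ∷ as) = cong (a ∷_) (trans (sym (map-∘ (select as))) (select-keys as))

  select-↭ : ∀ {n} (as : Vec X (suc n)) {a r} → (a , r) ∈ select as → a ∷ toList r ↭ toList as
  select-↭ {zero} (a ∷ []) (here refl) = ↭-refl
  select-↭ {suc n} (a ∷ as) (here refl) = ↭-refl
  select-↭ {suc n} (a ∷ as) (there m) with ∈-map⁻ _ m
  ... | (b , r) , m′ , refl = ↭-trans (Perm.swap b a ↭-refl) (prep a (select-↭ as m′))

  length-select : ∀ {n} (as : Vec X (suc n)) → length (select as) ≡ suc n
  length-select {zero} (a ∷ []) = refl
  length-select {suc n} (a ∷ as) = cong suc (trans (length-map _ (select as)) (length-select as))

  ∈-select : ∀ {n} (as : Vec X (suc n)) {a} → a ∈ toList as → ∃ λ r → (a , r) ∈ select as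
  ∈-select as {a} m with ∈-map⁻ proj₁ (subst (a ∈_) (sym (select-keys as)) m)
  ... | (_ , r) , m′ , refl = r , m′

  select-unique : ∀ {n} (as : Vec X (suc n)) → Unique (toList as) → AllPairs (λ x y → proj₁ x ≢ proj₁ y) (select as)
  select-unique as u = AllPairsP.map⁻ (subst Unique (sym (select-keys as)) u)

  rest-unique : ∀ {n} (as : Vec X (suc n)) {a r} → Unique (toList as) → (a , r) ∈ select as → Unique (toList r)
  rest-unique as u m with unique-resp-↭ (↭-sym (select-↭ as m)) u
  ... | _ ∷ u′ = u′

  perms-↭ : ∀ {n} (as : Vec X n) {x} → x ∈ perms as → toList x ↭ toList as
  perms-↭ [] (here refl) = ↭-refl
  perms-↭ as@(_ ∷ _) m with find (∈-concatMap⁻ startingWith {xs = select as} m)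
  ... | (a , r) , s , n with ∈-map⁻ (a ∷_) n
  ...   | y , k , refl = ↭-trans (prep a (perms-↭ r k)) (select-↭ as s)

  ↭-perms : ∀ {n} (as : Vec X n) {x} → toList x ↭ toList as → x ∈ perms as
  ↭-perms [] {[]} p = here refl
  ↭-perms as@(_ ∷ _) {a ∷ x} p =
    let r , m = ∈-select as (∈-resp-↭ p (here refl))
    in ∈-concatMap⁺ startingWith
         (lose m (∈-map⁺ (a ∷_) (↭-perms r (drop-∷ (↭-trans p (↭-sym (select-↭ as m)))))))

  perms-unique : ∀ {n} (as : Vec X n) → Unique (toList as) → Unique (perms as)
  perms-unique [] u = [] ∷ []
  perms-unique as@(_ ∷ _) u = unique-concatMap head proj₁ (select-unique as u)
    (λ {(a , r)} m → map⁺ (λ { refl → refl }) (perms-unique r (rest-unique as u m)))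
    (λ {(a , r)} _ m → key a (∈-map⁻ (a ∷_) m))
    where
    key : ∀ a {y : Vec X _} {P : Vec X _ → Set} → (∃ λ z → P z × y ≡ a ∷ z) → head y ≡ a
    key a (z , _ , refl) = refl

  perms-distinct : ∀ {n} (as : Vec X n) {x} → Unique (toList as) → x ∈ perms as → Distinct x
  perms-distinct as u m = unique⇒distinct (unique-resp-↭ (↭-sym (perms-↭ as m)) u)

  ∑-perms-const : ∀ {n} (as : Vec X n) c → ∑ (perms as) (λ _ → c) ≡ n ! * c
  ∑-perms-const [] c = refl
  ∑-perms-const {suc n} as@(_ ∷ _) c = begin
    ∑ (perms as) (λ _ → c)                               ≡⟨ ∑-perms as _ ⟩
    ∑ (select as) (λ (a , r) → ∑ (perms r) (λ _ → c))    ≡⟨ ∑-cong (select as) (λ (a , r) → ∑-perms-const r c) ⟩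
    ∑ (select as) (λ _ → n ! * c)                        ≡⟨ ∑-const (select as) _ ⟩
    length (select as) * (n ! * c)                       ≡⟨ cong (_* (n ! * c)) (length-select as) ⟩
    suc n * (n ! * c)                                    ≡⟨ *-assoc (suc n) (n !) c ⟨
    suc n * n ! * c                                      ∎
    where open ≡-Reasoning

  act : ∀ {n} → Vec X n → Fin n × Fin n → Vec X n
  act x (i , j) = swapAt x i j

  act-perms : ∀ {n} (as : Vec X n) {x} i j → toℕ i < toℕ j → x ∈ perms as → act x (i , j) ∈ perms as
  act-perms as {x} i j i<j m = ↭-perms as (↭-trans (↭-sym (~⇒↭ (~-swapAt x i j i<j))) (perms-↭ as m))

  -- A transposition is an involution on the arrangements, so the sum may be reindexed along it; one
  -- inequality, used twice, gives equality.
  ∑-act : ∀ {n} (as : Vec X n) → Unique (toList as) → ∀ i j → toℕ i < toℕ j → ∀ f →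
    ∑ (perms as) (λ x → f (act x (i , j))) ≡ ∑ (perms as) f
  ∑-act as u i j i<j f = ≤-antisym (le f) (≤-trans
    (≤-reflexive (∑-cong (perms as) (λ x → cong f (sym (swapAt-involutive x i j))))) (le (λ x → f (act x (i , j)))))
    where
    g : Vec X _ → Vec X _
    g x = act x (i , j)
    le : ∀ f → ∑ (perms as) (λ x → f (g x)) ≤ ∑ (perms as) f
    le f = ≤-trans (≤-reflexive (sym (∑-map (perms as) g f))) (∑-⊆ f
      (map⁺ (λ {x} {y} e → trans (sym (swapAt-involutive x i j)) (trans (cong g e) (swapAt-involutive y i j)))
        (perms-unique as u))
      (λ m → image (∈-map⁻ g m)))
      where
      image : ∀ {y} → (∃ λ x → x ∈ perms as × y ≡ g x) → y ∈ perms as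
      image (x , m , refl) = act-perms as i j i<j m

  size : ∀ {n} → Vec X n → (Vec X n → Bool) → ℕ
  size as S = ∑ (perms as) (λ x → ⟦ S x ⟧)

  leaves : ∀ {n} → (Vec X n → Bool) → Vec X n → Fin n × Fin n → ℕ
  leaves S x g = ⟦ S x ∧ not (S (act x g)) ⟧

  -- Each edge of the cut is counted once, from its end in `S`.
  boundary : ∀ {n} → Vec X n → (Vec X n → Bool) → ℕ
  boundary {n} as S = ∑ (perms as) (λ x → ∑ (generators n) (leaves S x))

  complement : ∀ {n} → (Vec X n → Bool) → Vec X n → Bool
  complement S x = not (S x)

  size-complement : ∀ {n} (as : Vec X n) S → size as S + size as (complement S) ≡ n !
  size-complement {n} as S = trans (sym (∑-+ (perms as) _ _)) (trans (∑-cong (perms as) (λ x → one (S x)))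
    (trans (∑-perms-const as 1) (*-identityʳ (n !))))
    where
    one : ∀ b → ⟦ b ⟧ + ⟦ not b ⟧ ≡ 1
    one true = refl
    one false = refl

  ∑-generator-symmetric : ∀ {n} (as : Vec X n) S → Unique (toList as) → ∀ i j → toℕ i < toℕ j →
    ∑ (perms as) (λ x → leaves (complement S) x (i , j)) ≡ ∑ (perms as) (λ x → leaves S x (i , j))
  ∑-generator-symmetric as S u i j i<j = trans
    (∑-cong (perms as) (λ x → cong ⟦_⟧ (flip x)))
    (∑-act as u i j i<j (λ x → leaves S x (i , j)))
    where
    flip : ∀ x → not (S x) ∧ not (not (S (act x (i , j)))) ≡ S (act x (i , j)) ∧ not (S (act (act x (i , j)) (i , j)))
    flip x rewrite swapAt-involutive x i j | not-involutive (S (act x (i , j))) =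
      ∧-comm (not (S x)) (S (act x (i , j)))

  boundary-complement : ∀ {n} (as : Vec X n) S → Unique (toList as) → boundary as (complement S) ≡ boundary as S
  boundary-complement {n} as S u = trans (∑-swap (perms as) (generators n) _)
    (trans (∑-cong∈ (generators n) (λ {(i , j)} m → ∑-generator-symmetric as S u i j (generators-< n m)))
    (sym (∑-swap (perms as) (generators n) _)))

  crossing : ∀ {n} → Vec X n → (Vec X n → Bool) → Fin n → Fin n → ℕ
  crossing as S i j = ∑ (perms as) (λ x → leaves S x (i , j))

  -- Of the generators, only the swaps of the head with the second and with the last entry change
  -- the head; the others act inside a copy as its own generators.
  boundary-split : ∀ {k} (as : Vec X (3 + k)) S →
    boundary as S ≡ crossing as S zero (suc zero) + (crossing as S zero (fromℕ (2 + k)) +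
      ∑ (select as) (λ (a , r) → boundary r (λ x → S (a ∷ x))))
  boundary-split {k} as S = trans (∑-+ (perms as) _ _) (cong (crossing as S zero (suc zero) +_)
    (trans (∑-+ (perms as) _ _) (cong (crossing as S zero (fromℕ (2 + k)) +_)
    (trans (∑-cong (perms as) (λ x → ∑-map (generators (2 + k)) _ (leaves S x)))
    (∑-perms as _)))))

-- Small vertex sets

-- A bipartite graph on at most 3 vertices is a forest and has fewer edges than vertices. The term
-- `1 ⊓ (p + q)` admits the empty set.
bipartite-sparse : ∀ p q → p + q ≤ 3 → 2 * (p * q) + 2 * (1 ⊓ (p + q)) ≤ 2 * (p + q)
bipartite-sparse zero q h = *-monoʳ-≤ 2 (m⊓n≤n 1 q)
bipartite-sparse (suc p) zero h rewrite *-zeroʳ p = *-monoʳ-≤ 2 (m⊓n≤n 1 (suc p + 0))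
bipartite-sparse 1 1 h = ≤ᵇ⇒≤ _ _ tt
bipartite-sparse 1 2 h = ≤ᵇ⇒≤ _ _ tt
bipartite-sparse 2 1 h = ≤ᵇ⇒≤ _ _ tt
bipartite-sparse 1 (suc (suc (suc q))) (s≤s (s≤s (s≤s ())))
bipartite-sparse 2 (suc (suc q)) (s≤s (s≤s (s≤s ())))
bipartite-sparse (suc (suc (suc p))) (suc q) (s≤s (s≤s (s≤s h))) rewrite +-suc p q with () ← h

module _ {m : ℕ} where

  Word : ℕ → Set
  Word n = Vec (Fin m) n

  evenSize oddSize : ∀ {n} → Word n → (Word n → Bool) → ℕ
  oddSize as S = ∑ (perms as) (λ x → ⟦ S x ∧ parity x ⟧)
  evenSize as S = ∑ (perms as) (λ x → ⟦ S x ∧ not (parity x) ⟧)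

  size-parity : ∀ {n} (as : Word n) S → size as S ≡ oddSize as S + evenSize as S
  size-parity as S = trans (∑-cong (perms as) (λ x → ⟦⟧-split (S x) (parity x))) (∑-+ (perms as) _ _)

  -- Each of the 1 + 2k generators at a member of `S` leads out of `S` or to a member of the other
  -- parity.
  boundary-degree : ∀ {k} (as : Word (2 + k)) S → Unique (toList as) →
    (1 + 2 * k) * size as S ≤ boundary as S + 2 * (oddSize as S * evenSize as S)
  boundary-degree {k} as S u = begin
    (1 + 2 * k) * size as S                                       ≡⟨ ∑-*ˡ (perms as) (1 + 2 * k) _ ⟨
    ∑ (perms as) (λ x → (1 + 2 * k) * ⟦ S x ⟧)                    ≡⟨ ∑-cong (perms as) degree ⟩
    _                                                             ≡⟨ ∑-+ (perms as) _ _ ⟩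
    boundary as S + ∑ (perms as) (λ x → ⟦ S x ⟧ * ∑ (nb x) (λ y → ⟦ S y ⟧)) ≤⟨ +-monoʳ-≤ (boundary as S)
      (bipartite-bound parity S (perms as) nb nb-unique (λ {x} m n → nb-perms m (∈-map⁻ (act x) n))
        (λ {x} m n → nb-parity m (∈-map⁻ (act x) n))) ⟩
    _ ∎
    where
    open ≤-Reasoning
    gens′ = generators (2 + k)
    nb : Word (2 + k) → List (Word (2 + k))
    nb x = map (act x) gens′
    inside : ∀ x → ⟦ S x ⟧ * ∑ (nb x) (λ y → ⟦ S y ⟧) ≡ ∑ gens′ (λ g → ⟦ S x ⟧ * ⟦ S (act x g) ⟧)
    inside x = trans (cong (⟦ S x ⟧ *_) (∑-map gens′ (act x) _)) (sym (∑-*ˡ gens′ ⟦ S x ⟧ _))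
    split : ∀ s t → ⟦ s ⟧ ≡ ⟦ s ∧ not t ⟧ + ⟦ s ⟧ * ⟦ t ⟧
    split true true = refl
    split true false = refl
    split false t = refl
    degree : ∀ x → (1 + 2 * k) * ⟦ S x ⟧ ≡ ∑ gens′ (leaves S x) + ⟦ S x ⟧ * ∑ (nb x) (λ y → ⟦ S y ⟧)
    degree x = trans (cong (_* ⟦ S x ⟧) (sym (length-generators k))) (trans (sym (∑-const gens′ _))
      (trans (∑-cong gens′ (λ g → split (S x) (S (act x g))))
      (trans (∑-+ gens′ _ _) (cong (∑ gens′ (leaves S x) +_) (sym (inside x))))))
    nb-unique : ∀ {x} → x ∈ perms as → Unique (nb x)
    nb-unique {x} m = unique-map (λ g∈ h∈ → swapAt-injective x (perms-distinct as u m)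
      (generators-< (2 + k) g∈) (generators-< (2 + k) h∈)) (generators-unique (2 + k))
    nb-perms : ∀ {x y} → x ∈ perms as → (∃ λ g → g ∈ gens′ × y ≡ act x g) → y ∈ perms as
    nb-perms m ((i , j) , g∈ , refl) = act-perms as i j (generators-< (2 + k) g∈) m
    nb-parity : ∀ {x y} → x ∈ perms as → (∃ λ g → g ∈ gens′ × y ≡ act x g) → parity y ≡ not (parity x)
    nb-parity {x} m ((i , j) , g∈ , refl) =
      parity-~ (unique-resp-↭ (↭-sym (perms-↭ as m)) u) (~-swapAt x i j (generators-< (2 + k) g∈))

  -- From the degree 5 + 2k of each of s members, at most 2(s - 1) is lost to inner edges. The form
  -- without subtraction, valid also for s = 0, can be summed over copies.
  boundary-light : ∀ {k} (as : Word (4 + k)) S → Unique (toList as) → size as S ≤ 3 →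
    (3 + 2 * k) * size as S + 2 * (1 ⊓ size as S) ≤ boundary as S
  boundary-light {k} as S u s≤3 rewrite size-parity as S =
    linear 0 (+-mono-≤ (subst (λ s → (1 + 2 * (2 + k)) * s ≤ boundary as S + 2 * (p * q)) (size-parity as S) (boundary-degree as S u))
      (bipartite-sparse p q s≤3))
      (identity k (p + q) (1 ⊓ (p + q)) (boundary as S) (p * q))
    where
    p = oddSize as S
    q = evenSize as S
    identity : ∀ k s e b r → (3 + 2 * k) * s + 2 * e + (b + 2 * r + 2 * s) + 0 ≡
      b + ((1 + 2 * (2 + k)) * s + (2 * r + 2 * e))
    identity = solve-∀

  -- Four members span at most 4 edges and five at most 6, so the boundary is at least 4(5 + 2k) - 8
  -- or 5(5 + 2k) - 12.
  boundary-4-5 : ∀ {k} (as : Word (4 + k)) S → Unique (toList as) → 4 ≤ size as S → size as S ≤ 5 →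
    12 + 8 * k ≤ boundary as S
  boundary-4-5 {k} as S u 4≤s s≤5 rewrite size-parity as S =
    finish (m≤n⇒∃[o]m+o≡n 4≤s) (subst (λ s → (1 + 2 * (2 + k)) * s ≤ boundary as S + 2 * (p * q)) (size-parity as S) (boundary-degree as S u))
    where
    p = oddSize as S
    q = evenSize as S
    b = boundary as S
    product₄ : ∀ p q → p + q ≡ 4 → p * q ≤ 4
    product₄ 0 q refl = z≤n
    product₄ 1 q refl = ≤ᵇ⇒≤ _ _ tt
    product₄ 2 q refl = ≤ᵇ⇒≤ _ _ tt
    product₄ 3 q refl = ≤ᵇ⇒≤ _ _ tt
    product₄ 4 q refl = ≤ᵇ⇒≤ _ _ tt
    product₅ : ∀ p q → p + q ≡ 5 → p * q ≤ 6
    product₅ 0 q refl = z≤n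
    product₅ 1 q refl = ≤ᵇ⇒≤ _ _ tt
    product₅ 2 q refl = ≤ᵇ⇒≤ _ _ tt
    product₅ 3 q refl = ≤ᵇ⇒≤ _ _ tt
    product₅ 4 q refl = ≤ᵇ⇒≤ _ _ tt
    product₅ 5 q refl = ≤ᵇ⇒≤ _ _ tt
    finish : (∃ λ o → 4 + o ≡ p + q) → (1 + 2 * (2 + k)) * (p + q) ≤ b + 2 * (p * q) → 12 + 8 * k ≤ b
    finish (0 , e) h = linear 0 (+-mono-≤ (subst (λ s → (1 + 2 * (2 + k)) * s ≤ b + 2 * (p * q)) (sym e) h)
      (*-monoʳ-≤ 2 (product₄ p q (sym e)))) (identity k b (p * q))
      where
      identity : ∀ k b r → 12 + 8 * k + (b + 2 * r + 2 * 4) + 0 ≡ b + ((1 + 2 * (2 + k)) * 4 + 2 * r)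
      identity = solve-∀
    finish (1 , e) h = linear (1 + 2 * k) (+-mono-≤ (subst (λ s → (1 + 2 * (2 + k)) * s ≤ b + 2 * (p * q)) (sym e) h)
      (*-monoʳ-≤ 2 (product₅ p q (sym e)))) (identity k b (p * q))
      where
      identity : ∀ k b r → 12 + 8 * k + (b + 2 * r + 2 * 6) + (1 + 2 * k) ≡ b + ((1 + 2 * (2 + k)) * 5 + 2 * r)
      identity = solve-∀
    finish (suc (suc o) , e) h = contradiction (≤-trans (≤-reflexive e) s≤5) (λ { (s≤s (s≤s (s≤s (s≤s (s≤s ()))))) })

-- The case n = 4

-- A branch-and-bound search: the 24 vertices of BS₄ are assigned to S or to
-- its complement one after another, and a branch is closed as soon as 12
-- boundary edges lie between assigned vertices.

entry : List Bool → ℕ → Maybe Bool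
entry [] i = nothing
entry (b ∷ bs) zero = just b
entry (b ∷ bs) (suc i) = entry bs i

cutValue : Maybe Bool → Maybe Bool → ℕ
cutValue (just b) (just c) = ⟦ b ∧ not c ⟧
cutValue _ _ = 0

arcValue : List Bool → ℕ × ℕ → ℕ
arcValue bs (i , j) = cutValue (entry bs i) (entry bs j)

-- The groups hold, for each vertex still to be assigned, the arcs that become decided together with
-- it; the last argument counts the cut arcs found so far. A complete assignment also passes if its
-- size lies outside the range from 4 to 20.
search₄ : List (List (ℕ × ℕ)) → List Bool → ℕ → Bool
search₄ [] bs c = (12 ≤ᵇ c) ∨ ((∑ bs ⟦_⟧ <ᵇ 4) ∨ (20 <ᵇ ∑ bs ⟦_⟧))
search₄ (g ∷ gs) bs c = if 12 ≤ᵇ c then true else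
  (search₄ gs (bs ∷ʳ true) (c + ∑ g (arcValue (bs ∷ʳ true))) ∧
   search₄ gs (bs ∷ʳ false) (c + ∑ g (arcValue (bs ∷ʳ false))))

entry-++ : ∀ bs cs i {b} → entry bs i ≡ just b → entry (bs ++ cs) i ≡ just b
entry-++ (b ∷ bs) cs zero e = e
entry-++ (b ∷ bs) cs (suc i) e = entry-++ bs cs i e

arcValue-mono : ∀ bs cs a → arcValue bs a ≤ arcValue (bs ++ cs) a
arcValue-mono bs cs (i , j) with entry bs i in e | entry bs j in f
... | just b | just c rewrite entry-++ bs cs i e | entry-++ bs cs j f = ≤-refl
... | just b | nothing = z≤n
... | nothing | just c = z≤n
... | nothing | nothing = z≤n

≤ᵇ-true : ∀ {m n} → (m ≤ᵇ n) ≡ true → m ≤ n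
≤ᵇ-true {m} {n} e = ≤ᵇ⇒≤ m n (subst T (sym e) tt)

search₄-sound : ∀ gs bs c → search₄ gs bs c ≡ true → ∀ cs → length cs ≡ length gs →
  4 ≤ ∑ (bs ++ cs) ⟦_⟧ → ∑ (bs ++ cs) ⟦_⟧ ≤ 20 →
  12 ≤ c + ∑ gs (λ g → ∑ g (arcValue (bs ++ cs)))
search₄-sound gs bs c e cs l lo hi with 12 ≤ᵇ c in big
search₄-sound gs bs c e cs l lo hi | true = ≤-trans (≤ᵇ-true big) (m≤m+n c _)
search₄-sound [] bs c e [] l lo hi | false rewrite big with ∑ bs ⟦_⟧ <ᵇ 4 in small
... | true = contradiction (≤ᵇ-true {suc (∑ bs ⟦_⟧)} small)
  (≤⇒≯ (subst (λ xs → 4 ≤ ∑ xs ⟦_⟧) (++-identityʳ bs) lo))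
... | false = contradiction (≤ᵇ-true {21} e) (≤⇒≯ (subst (λ xs → ∑ xs ⟦_⟧ ≤ 20) (++-identityʳ bs) hi))
search₄-sound (g ∷ gs) bs c e (b ∷ cs) l lo hi | false rewrite big =
  ≤-trans (search₄-sound gs (bs ∷ʳ b) _ (branch b e) cs (suc-injective l)
     (subst (λ xs → 4 ≤ ∑ xs ⟦_⟧) (sym assoc) lo) (subst (λ xs → ∑ xs ⟦_⟧ ≤ 20) (sym assoc) hi))
  (≤-trans (≤-reflexive (+-assoc c _ _)) (+-monoʳ-≤ c (+-mono-≤
    (∑-mono g (λ a → subst (λ xs → arcValue (bs ∷ʳ b) a ≤ arcValue xs a) assoc (arcValue-mono (bs ∷ʳ b) cs a)))
    (≤-reflexive (cong (λ xs → ∑ gs (λ g → ∑ g (arcValue xs))) assoc)))))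
  where
  assoc : (bs ∷ʳ b) ++ cs ≡ bs ++ b ∷ cs
  assoc = ++-assoc bs (b ∷ []) cs
  ∧-true : ∀ {x y} → x ∧ y ≡ true → x ≡ true × y ≡ true
  ∧-true {true} {true} refl = refl , refl
  branch : ∀ b → search₄ gs (bs ∷ʳ true) (c + ∑ g (arcValue (bs ∷ʳ true))) ∧
     search₄ gs (bs ∷ʳ false) (c + ∑ g (arcValue (bs ∷ʳ false))) ≡ true →
     search₄ gs (bs ∷ʳ b) (c + ∑ g (arcValue (bs ∷ʳ b))) ≡ true
  branch true e = proj₁ (∧-true e)
  branch false e = proj₂ (∧-true e)

-- `groupArcs n i` splits off the arcs whose larger end is i, i+1, …, i+n-1.
groupArcs : ℕ → ℕ → List (ℕ × ℕ) → List (List (ℕ × ℕ))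
groupArcs zero i as = []
groupArcs (suc n) i as = filterᵇ (λ (j , k) → j ⊔ k ≤ᵇ i) as ∷
  groupArcs n (suc i) (filterᵇ (λ (j , k) → not (j ⊔ k ≤ᵇ i)) as)

groupArcs-∑ : ∀ n i as f → ∑ (groupArcs n i as) (λ g → ∑ g f) ≤ ∑ as f
groupArcs-∑ zero i as f = z≤n
groupArcs-∑ (suc n) i as f = ≤-trans (+-monoʳ-≤ _ (groupArcs-∑ n (suc i) _ f))
  (≤-reflexive (∑-filter (λ (j , k) → j ⊔ k ≤ᵇ i) as f))
  where
  ∑-filter : ∀ {A : Set} p (xs : List A) f → ∑ (filterᵇ p xs) f + ∑ (filterᵇ (λ x → not (p x)) xs) f ≡ ∑ xs f
  ∑-filter p [] f = refl
  ∑-filter p (x ∷ xs) f with p x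
  ... | true = trans (+-assoc (f x) _ _) (cong (f x +_) (∑-filter p xs f))
  ... | false = trans (sym (+-assoc (∑ (filterᵇ p xs) f) (f x) _))
    (trans (cong (_+ ∑ (filterᵇ (λ x → not (p x)) xs) f) (+-comm (∑ (filterᵇ p xs) f) (f x)))
    (trans (+-assoc (f x) _ _) (cong (f x +_) (∑-filter p xs f))))

words₄ : List (Vec (Fin 4) 4)
words₄ = perms (Vec.allFin 4)

rank₄ : Vec (Fin 4) 4 → ℕ
rank₄ x = position words₄
  where
  position : List (Vec (Fin 4) 4) → ℕ
  position [] = 0
  position (y ∷ ys) = if does (VecP.≡-dec FinP._≟_ x y) then 0 else suc (position ys)

row₄ : Vec (Fin 4) 4 → List (ℕ × ℕ)
row₄ x = map (λ g → rank₄ x , rank₄ (act x g)) (generators 4)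

arcs₄ : List (ℕ × ℕ)
arcs₄ = concatMap row₄ words₄

groups₄ : List (List (ℕ × ℕ))
groups₄ = groupArcs 24 0 arcs₄

-- The first `refl` runs the search, on ranks computed over `Fin 4`. Since the order of `perms`
-- depends on positions and not on letters, the sum over these ranks unfolds to the boundary for any
-- four letters.
boundary₄ : ∀ {X : Set} (as : Vec X 4) S → 4 ≤ size as S → size as S ≤ 20 → 12 ≤ boundary as S
boundary₄ as@(p ∷ q ∷ r ∷ t ∷ []) S lo hi = begin
  12                                             ≤⟨ search₄-sound groups₄ [] 0 refl bits refl
                                                      (subst (4 ≤_) size≡ lo) (subst (_≤ 20) size≡ hi) ⟩
  ∑ groups₄ (λ g → ∑ g (arcValue bits))          ≤⟨ groupArcs-∑ 24 0 arcs₄ (arcValue bits) ⟩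
  ∑ arcs₄ (arcValue bits)                        ≡⟨ ∑-concatMap words₄ row₄ (arcValue bits) ⟩
  ∑ words₄ (λ x → ∑ (row₄ x) (arcValue bits))    ≡⟨⟩
  boundary as S                                  ∎
  where
  open ≤-Reasoning
  bits = map S (perms as)
  size≡ : size as S ≡ ∑ bits ⟦_⟧
  size≡ = sym (∑-map (perms as) S ⟦_⟧)

-- The isoperimetric inequality

≤ᵇ-false : ∀ {m n} → (m ≤ᵇ n) ≡ false → n < m
≤ᵇ-false e = ≰⇒> λ h → subst T e (≤⇒≤ᵇ h)

-- A copy of order `M` with at most 3 vertices in `S` and at most 3 outside would have at most 6.
rich-poor : ∀ M s → 7 ≤ M → (M ≤ᵇ 3 + s) ∧ (s ≤ᵇ 3) ≡ false
rich-poor M s 7≤M with M ≤ᵇ 3 + s in p | s ≤ᵇ 3 in q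
... | false | _ = refl
... | true | false = refl
... | true | true = contradiction (≤-trans 7≤M (≤-trans (≤ᵇ-true {M} p) (+-monoʳ-≤ 3 (≤ᵇ-true {s} q))))
      λ { (s≤s (s≤s (s≤s (s≤s (s≤s (s≤s ())))))) }

module _ {X : Set} where

  count : ∀ {n} → (X → Bool) → Vec X n → ℕ
  count h as = ∑ (toList as) (λ a → ⟦ h a ⟧)

  ∑-select-head : ∀ {n} (as : Vec X (suc n)) (f : X → ℕ) → ∑ (select as) (λ y → f (proj₁ y)) ≡ ∑ (toList as) f
  ∑-select-head as f = trans (sym (∑-map (select as) proj₁ f)) (cong (λ l → ∑ l f) (select-keys as))

  -- As no letter satisfies both `h` and `l`, using up a first letter from `h` does not reduce the
  -- choices for the second; the remaining `k` letters are arranged freely.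
  mixed-pairs : ∀ {k} (as : Vec X (2 + k)) (h l : X → Bool) → (∀ a → h a ∧ l a ≡ false) →
    ∑ (perms as) (λ x → ⟦ h (head x) ∧ l (head (Vec.tail x)) ⟧) ≡ k ! * (count h as * count l as)
  mixed-pairs {k} as h l h∧l = begin
    ∑ (perms as) (λ x → ⟦ h (head x) ∧ l (head (Vec.tail x)) ⟧)
      ≡⟨ ∑-perms as _ ⟩
    ∑ (select as) (λ (a , r) → ∑ (perms r) (λ x → ⟦ h a ∧ l (head x) ⟧))
      ≡⟨ ∑-cong∈ (select as) (λ {(a , r)} m → second a r m) ⟩
    ∑ (select as) (λ (a , r) → ⟦ h a ⟧ * (k ! * count l as))
      ≡⟨ ∑-*ʳ (select as) _ _ ⟩
    ∑ (select as) (λ (a , r) → ⟦ h a ⟧) * (k ! * count l as)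
      ≡⟨ cong (_* (k ! * count l as)) (∑-select-head as (λ a → ⟦ h a ⟧)) ⟩
    count h as * (k ! * count l as)
      ≡⟨ identity (count h as) (k !) (count l as) ⟩
    k ! * (count h as * count l as) ∎
    where
    open ≡-Reasoning
    identity : ∀ p c q → p * (c * q) ≡ c * (p * q)
    identity = solve-∀
    weigh : ∀ a b → ⟦ h a ∧ l b ⟧ ≡ ⟦ h a ⟧ * ⟦ l b ⟧
    weigh a b with h a
    ... | true = sym (+-identityʳ ⟦ l b ⟧)
    ... | false = refl
    others : ∀ a r → (a , r) ∈ select as → ⟦ h a ⟧ * count l r ≡ ⟦ h a ⟧ * count l as
    others a r m with h a | h∧l a
    ... | false | _ = refl
    ... | true | la rewrite sym (∑-↭ (λ a → ⟦ l a ⟧) (select-↭ as m)) | la = refl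
    second : ∀ a r → (a , r) ∈ select as → ∑ (perms r) (λ x → ⟦ h a ∧ l (head x) ⟧) ≡ ⟦ h a ⟧ * (k ! * count l as)
    second a r m = begin
      ∑ (perms r) (λ x → ⟦ h a ∧ l (head x) ⟧)       ≡⟨ ∑-perms r _ ⟩
      ∑ (select r) (λ (b , r′) → ∑ (perms r′) (λ _ → ⟦ h a ∧ l b ⟧))
        ≡⟨ ∑-cong (select r) (λ (b , r′) → trans (∑-perms-const r′ _) (cong (k ! *_) (weigh a b))) ⟩
      ∑ (select r) (λ (b , r′) → k ! * (⟦ h a ⟧ * ⟦ l b ⟧)) ≡⟨ trans (∑-*ˡ (select r) (k !) _) (cong (k ! *_) (∑-*ˡ (select r) ⟦ h a ⟧ _)) ⟩
      k ! * (⟦ h a ⟧ * ∑ (select r) (λ (b , r′) → ⟦ l b ⟧)) ≡⟨ cong (λ q → k ! * (⟦ h a ⟧ * q)) (∑-select-head r (λ b → ⟦ l b ⟧)) ⟩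
      k ! * (⟦ h a ⟧ * count l r)                           ≡⟨ cong (k ! *_) (others a r m) ⟩
      k ! * (⟦ h a ⟧ * count l as)                          ≡⟨ identity (k !) ⟦ h a ⟧ (count l as) ⟩
      ⟦ h a ⟧ * (k ! * count l as) ∎

  -- Take a word whose first letter is in `h` and second in `l`, and exchange the two. Either this
  -- edge leaves `S`, or the first word is missing from `S` in a copy of kind `h`, or the second
  -- lies in `S` in a copy of kind `l`. Exceptions of the latter kinds form the sum on the right.
  mixed-bound : ∀ {k} (as : Vec X (2 + k)) → Unique (toList as) → (h l : X → Bool) → (∀ a → h a ∧ l a ≡ false) → ∀ S →
    k ! * (count h as * count l as) ≤ crossing as S zero (suc zero) +
      ∑ (select as) (λ (a , r) → ∑ (perms r) (λ x → ⟦ h a ∧ not (S (a ∷ x)) ⟧ + ⟦ l a ∧ S (a ∷ x) ⟧))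
  mixed-bound {k} as u h l h∧l S = begin
    k ! * (count h as * count l as)
      ≡⟨ mixed-pairs as h l h∧l ⟨
    ∑ (perms as) (λ x → ⟦ h (head x) ∧ l (head (Vec.tail x)) ⟧)
      ≤⟨ ∑-mono (perms as) pointwise ⟩
    ∑ (perms as) (λ x → leaves S x σ + (⟦ h (head x) ∧ not (S x) ⟧ + poor (act x σ)))
      ≡⟨ trans (∑-+ (perms as) _ _) (cong (crossing as S zero (suc zero) +_) (∑-+ (perms as) _ _)) ⟩
    crossing as S zero (suc zero) + (∑ (perms as) (λ x → ⟦ h (head x) ∧ not (S x) ⟧) + ∑ (perms as) (λ x → poor (act x σ)))
      ≡⟨ cong (λ s → crossing as S zero (suc zero) + (∑ (perms as) (λ x → ⟦ h (head x) ∧ not (S x) ⟧) + s)) (∑-act as u zero (suc zero) (s≤s z≤n) poor) ⟩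
    crossing as S zero (suc zero) + (∑ (perms as) (λ x → ⟦ h (head x) ∧ not (S x) ⟧) + ∑ (perms as) poor)
      ≡⟨ cong (crossing as S zero (suc zero) +_) (trans (sym (∑-+ (perms as) _ _)) (∑-perms as _)) ⟩
    _ ∎
    where
    open ≤-Reasoning
    σ : Fin (2 + k) × Fin (2 + k)
    σ = zero , suc zero
    poor : Vec X (2 + k) → ℕ
    poor x = ⟦ l (head x) ∧ S x ⟧
    bools : ∀ h l s t → ⟦ h ∧ l ⟧ ≤ ⟦ s ∧ not t ⟧ + (⟦ h ∧ not s ⟧ + ⟦ l ∧ t ⟧)
    bools false l s t = z≤n
    bools true false s t = z≤n
    bools true true true true = ≤-refl
    bools true true true false = ≤-refl
    bools true true false t = s≤s z≤n
    pointwise : ∀ x → ⟦ h (head x) ∧ l (head (Vec.tail x)) ⟧ ≤ leaves S x σ + (⟦ h (head x) ∧ not (S x) ⟧ + poor (act x σ))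
    pointwise (a ∷ b ∷ x) = bools (h a) (l b) (S (a ∷ b ∷ x)) (S (b ∷ a ∷ x))

-- The induction step over the copies

module _ {m : ℕ} where

  onlyˢ exceptˢ : ∀ {n} → Fin m → (Fin m × Word {m} n → ℕ) → Fin m × Word {m} n → ℕ
  onlyˢ = only FinP._≟_ proj₁
  exceptˢ = except FinP._≟_ proj₁

  module Copies {k : ℕ} (iso : ∀ (as : Word {m} (4 + k)) → Unique (toList as) → ∀ S → 4 ≤ size as S →
                   4 + size as S ≤ (4 + k) ! → 12 + 8 * k ≤ boundary as S)
    (as : Word {m} (5 + k)) (u : Unique (toList as)) (S : Word {m} (5 + k) → Bool) where

    copySize copyBoundary : Fin m × Word {m} (4 + k) → ℕ
    copySize (a , r) = size r (λ x → S (a ∷ x))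
    copyBoundary (a , r) = boundary r (λ x → S (a ∷ x))

    size-copies : size as S ≡ ∑ (select as) copySize
    size-copies = ∑-perms as _

    copy-unique : ∀ {c} → c ∈ select as → Unique (toList (proj₂ c))
    copy-unique m = rest-unique as u m

    medium : ∀ {c} → c ∈ select as → 4 ≤ copySize c → 4 + copySize c ≤ (4 + k) ! → 12 + 8 * k ≤ copyBoundary c
    medium m = iso _ (copy-unique m) _

    light : ∀ {c} → c ∈ select as → copySize c ≤ 3 → (3 + 2 * k) * copySize c + 2 * (1 ⊓ copySize c) ≤ copyBoundary c
    light {_ , r} m = boundary-light {k = k} r _ (copy-unique m)

    -- A generator that changes the head moves a copy out of itself.
    escape : ∀ {c} → c ∈ select as → ∀ j → toℕ {5 + k} zero < toℕ j →
      copySize c ≤ crossing as S zero j + ∑ (select as) (exceptˢ (proj₁ c) copySize)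
    escape {a , r} c∈ j 0<j = begin
      copySize (a , r)
        ≡⟨ ∑-only FinP._≟_ proj₁ copySize (select-unique as u) c∈ ⟨
      ∑ (select as) (onlyˢ a copySize)
        ≡⟨ ∑-cong (select as) (λ (b , r′) → inside b r′) ⟩
      ∑ (select as) (λ (b , r′) → ∑ (perms r′) (λ x → here′ (b ∷ x)))
        ≡⟨ ∑-perms as _ ⟨
      ∑ (perms as) here′
        ≤⟨ ∑-mono∈ (perms as) pointwise ⟩
      ∑ (perms as) (λ x → leaves S x (zero , j) + elsewhere (act x (zero , j)))
        ≡⟨ trans (∑-+ (perms as) _ _) (cong (crossing as S zero j +_) (∑-act as u zero j 0<j elsewhere)) ⟩
      crossing as S zero j + ∑ (perms as) elsewhere
        ≡⟨ cong (crossing as S zero j +_) (∑-perms as _) ⟩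
      crossing as S zero j + ∑ (select as) (λ (b , r′) → ∑ (perms r′) (λ x → elsewhere (b ∷ x)))
        ≡⟨ cong (crossing as S zero j +_) (∑-cong (select as) (λ (b , r′) → outside b r′)) ⟩
      crossing as S zero j + ∑ (select as) (exceptˢ a copySize) ∎
      where
      open ≤-Reasoning
      here′ elsewhere : Word (5 + k) → ℕ
      here′ x = if does (head x FinP.≟ a) then ⟦ S x ⟧ else 0
      elsewhere x = if does (head x FinP.≟ a) then 0 else ⟦ S x ⟧
      inside : ∀ b r′ → onlyˢ a copySize (b , r′) ≡ ∑ (perms r′) (λ x → here′ (b ∷ x))
      inside b r′ with does (b FinP.≟ a)
      ... | true = refl
      ... | false = sym (∑-0 (perms r′))
      outside : ∀ b r′ → ∑ (perms r′) (λ x → elsewhere (b ∷ x)) ≡ exceptˢ a copySize (b , r′)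
      outside b r′ with does (b FinP.≟ a)
      ... | true = ∑-0 (perms r′)
      ... | false = refl
      head-lookup : ∀ (x : Word (5 + k)) → head x ≡ lookup x zero
      head-lookup (_ ∷ _) = refl
      moved : ∀ {x} → x ∈ perms as → head (act x (zero , j)) ≢ head x
      moved {x} m e = contradiction
        (cong toℕ (perms-distinct as u m j zero
          (trans (sym (lookup-swapAtˡ x zero j)) (trans (sym (head-lookup (act x (zero , j)))) (trans e (head-lookup x))))))
        (λ q → <⇒≢ 0<j (sym q))
      pointwise : ∀ {x} → x ∈ perms as → here′ x ≤ leaves S x (zero , j) + elsewhere (act x (zero , j))
      pointwise {x} m with head x FinP.≟ a
      ... | no _ = z≤n
      ... | yes e with head (act x (zero , j)) FinP.≟ a
      ...   | yes e′ = contradiction (trans e′ (sym e)) (moved m)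
      ...   | no _ with S x | S (act x (zero , j))
      ...     | false | _ = z≤n
      ...     | true | true = ≤-refl
      ...     | true | false = ≤-refl

    boundary-copies : boundary as S ≡ crossing as S zero (suc zero) +
      (crossing as S zero (fromℕ (4 + k)) + ∑ (select as) copyBoundary)
    boundary-copies = boundary-split as S

    NotHeavy : Set
    NotHeavy = ∀ {c} → c ∈ select as → 4 + copySize c ≤ (4 + k) !

    -- As much as is asked of a copy beside a chosen one: two for each member, capped at the total
    -- gain of 8.
    copy-weak : NotHeavy → ∀ {c} → c ∈ select as → 8 ⊓ (2 * copySize c) ≤ copyBoundary c
    copy-weak nh {c} m with copySize c ≤? 3
    ... | yes s≤3 = ≤-trans (m⊓n≤n 8 _) (≤-trans
          (≤-trans (*-monoˡ-≤ (copySize c) (m≤m+n 2 (1 + 2 * k))) (m≤m+n _ _)) (light m s≤3))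
    ... | no s≰3 = ≤-trans (m⊓n≤m 8 _) (≤-trans (≤-trans (m≤m+n 8 4) (m≤m+n 12 _)) (medium m (≰⇒> s≰3) (nh m)))

    ⊓-∑ : ∀ {A : Set} (xs : List A) f → 8 ⊓ (2 * ∑ xs f) ≤ ∑ xs (λ x → 8 ⊓ (2 * f x))
    ⊓-∑ [] f = z≤n
    ⊓-∑ (x ∷ xs) f = ≤-trans (≤-reflexive (cong (8 ⊓_) (*-distribˡ-+ 2 (f x) _)))
      (≤-trans (sub (2 * f x) _) (+-monoʳ-≤ (8 ⊓ (2 * f x)) (⊓-∑ xs f)))
      where
      sub : ∀ a b → 8 ⊓ (a + b) ≤ 8 ⊓ a + 8 ⊓ b
      sub a b with ≤-total 8 a | ≤-total 8 b
      ... | inj₁ h | _ rewrite m≤n⇒m⊓n≡m h = ≤-trans (m⊓n≤m 8 _) (m≤m+n 8 _)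
      ... | inj₂ _ | inj₁ h rewrite m≤n⇒m⊓n≡m h = ≤-trans (m⊓n≤m 8 _) (m≤n+m 8 _)
      ... | inj₂ h | inj₂ h′ rewrite m≥n⇒m⊓n≡n h | m≥n⇒m⊓n≡n h′ = m⊓n≤n 8 _

    -- A copy with at least 4 members has 12 + 8k boundary edges of its own by the induction
    -- hypothesis. Each of the two generators that change the head sends these members into other
    -- copies, where they leave `S` unless they meet one of the `rest` members there. This loses at
    -- most 2 · `rest` of the desired 8, and `copy-weak` returns as much from the boundaries of the
    -- other copies.
    boundary-notHeavy : NotHeavy → 4 ≤ size as S → 20 + 8 * k ≤ boundary as S
    boundary-notHeavy nh 4≤s with any? (λ c → 4 ≤? copySize c) (select as)
    ... | yes some with c , c∈ , 4≤c ← find some =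
      subst (20 + 8 * k ≤_) (sym boundary-copies) (finish (8 ≤? 2 * rest))
      where
      X₁ X₂ rest others : ℕ
      X₁ = crossing as S zero (suc zero)
      X₂ = crossing as S zero (fromℕ (4 + k))
      rest = ∑ (select as) (exceptˢ (proj₁ c) copySize)
      others = ∑ (select as) (exceptˢ (proj₁ c) copyBoundary)
      β = copyBoundary c
      total : ∑ (select as) copyBoundary ≡ β + others
      total = ∑-pick FinP._≟_ proj₁ copyBoundary (select-unique as u) c∈
      12≤β : 12 + 8 * k ≤ β
      12≤β = medium c∈ 4≤c (nh c∈)
      others≥ : 8 ⊓ (2 * rest) ≤ others
      others≥ = ≤-trans (⊓-∑ (select as) _) (∑-mono∈ (select as) (λ {d} d∈ → weak d d∈))
        where
        weak : ∀ d → d ∈ select as → 8 ⊓ (2 * exceptˢ (proj₁ c) copySize d) ≤ exceptˢ (proj₁ c) copyBoundary d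
        weak d d∈ with does (proj₁ d FinP.≟ proj₁ c)
        ... | true = z≤n
        ... | false = copy-weak nh d∈
      X₁≥ : 4 ≤ X₁ + rest
      X₁≥ = ≤-trans 4≤c (escape c∈ (suc zero) (s≤s z≤n))
      X₂≥ : 4 ≤ X₂ + rest
      X₂≥ = ≤-trans 4≤c (escape c∈ (fromℕ (4 + k)) (s≤s z≤n))
      finish : Dec (8 ≤ 2 * rest) → 20 + 8 * k ≤ X₁ + (X₂ + ∑ (select as) copyBoundary)
      finish (yes 8≤) rewrite total =
        linear (X₁ + X₂) (+-mono-≤ 12≤β (subst (_≤ others) (m≤n⇒m⊓n≡m 8≤) others≥)) (identity k X₁ X₂ β others)
        where
        identity : ∀ k x y b o → 20 + 8 * k + (b + o) + (x + y) ≡ x + (y + (b + o)) + (12 + 8 * k + 8)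
        identity = solve-∀
      finish (no 8≰) rewrite total =
        linear 0 (+-mono-≤ 12≤β (+-mono-≤ (subst (_≤ others) (m≥n⇒m⊓n≡n (<⇒≤ (≰⇒> 8≰))) others≥) (+-mono-≤ X₁≥ X₂≥)))
          (identity k X₁ X₂ β others rest)
        where
        identity : ∀ k x y b o r → 20 + 8 * k + (b + (o + (x + r + (y + r)))) + 0 ≡
          x + (y + (b + o)) + (12 + 8 * k + (2 * r + (4 + 4)))
        identity = solve-∀
    -- Every copy is light, and at least two are occupied. The light bounds add up to (3 + 2k)s + 4
    -- or more, which suffices from s = 6 on but can fall short for s = 4 and s = 5.
    ... | no none with size as S ≤? 5
    ...   | yes s≤5 = ≤-trans (≤-reflexive (cong (12 +_) (sym (*-suc 8 k)))) (boundary-4-5 {k = suc k} as S u 4≤s s≤5)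
    ...   | no s≰5 = subst (20 + 8 * k ≤_) (sym boundary-copies)
            (≤-trans enough (≤-trans (m≤n+m _ (crossing as S zero (fromℕ (4 + k)))) (m≤n+m _ (crossing as S zero (suc zero)))))
      where
      s≤3 : ∀ {c} → c ∈ select as → copySize c ≤ 3
      s≤3 {c} m with copySize c ≤? 3
      ... | yes h = h
      ... | no h = contradiction (lose m (≰⇒> h)) none
      copies : ℕ
      copies = ∑ (select as) (λ c → 1 ⊓ copySize c)
      s≤3copies : size as S ≤ 3 * copies
      s≤3copies = ≤-trans (≤-reflexive size-copies) (≤-trans
        (∑-mono∈ (select as) (λ {c} m → threefold (copySize c) (s≤3 m)))
        (≤-reflexive (∑-*ˡ (select as) 3 _)))
        where
        threefold : ∀ s → s ≤ 3 → s ≤ 3 * (1 ⊓ s)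
        threefold zero h = z≤n
        threefold (suc s) h = h
      2≤copies : 2 ≤ copies
      2≤copies with copies in e
      ... | zero = contradiction (subst (size as S ≤_) (cong (3 *_) e) s≤3copies) (<⇒≱ (≤-trans (s≤s z≤n) 4≤s))
      ... | suc zero = contradiction (subst (size as S ≤_) (cong (3 *_) e) s≤3copies) (<⇒≱ 4≤s)
      ... | suc (suc _) = s≤s (s≤s z≤n)
      sum : (3 + 2 * k) * size as S + 2 * copies ≤ ∑ (select as) copyBoundary
      sum = ≤-trans (≤-reflexive (trans (cong₂ _+_
            (trans (cong ((3 + 2 * k) *_) size-copies) (sym (∑-*ˡ (select as) (3 + 2 * k) _)))
            (sym (∑-*ˡ (select as) 2 _))) (sym (∑-+ (select as) _ _))))
          (∑-mono∈ (select as) (λ m → light m (s≤3 m)))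
      enough : 20 + 8 * k ≤ ∑ (select as) copyBoundary
      enough = ≤-trans (linear (2 + 4 * k) (+-mono-≤ (*-monoʳ-≤ (3 + 2 * k) (≰⇒> s≰5)) (*-monoʳ-≤ 2 2≤copies))
        (identity k ((3 + 2 * k) * size as S) (2 * copies))) sum
        where
        identity : ∀ k a b → 20 + 8 * k + (a + b) + (2 + 4 * k) ≡ a + b + ((3 + 2 * k) * 6 + 2 * 2)
        identity = solve-∀

    factorial-large : ∀ k → 6 * suc k ≤ (3 + k) !
    factorial-large zero = ≤-refl
    factorial-large (suc k) = ≤-trans (linear (6 * k) (≤-refl {0}) (identity k))
      (*-mono-≤ {2} {4 + k} (s≤s (s≤s z≤n)) (factorial-large k))
      where
      identity : ∀ k → 6 * suc (suc k) + 0 + 6 * k ≡ 2 * (6 * suc k) + 0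
      identity = solve-∀

    7≤4+k! : 7 ≤ (4 + k) !
    7≤4+k! = ≤-trans (s≤s (s≤s (s≤s (s≤s (s≤s (s≤s (s≤s z≤n)))))))
      (*-mono-≤ {4} {4 + k} (m≤m+n 4 k) (≤-trans (*-monoʳ-≤ 6 {1} {suc k} (s≤s z≤n)) (factorial-large k)))

    -- A function of the letter alone, with value 0 where no copy has that head, because
    -- `mixed-bound` classifies letters and not copies.
    sizeAt : Fin m → ℕ
    sizeAt a = ∑ (select as) (onlyˢ a copySize)

    sizeAt-copy : ∀ {c} → c ∈ select as → sizeAt (proj₁ c) ≡ copySize c
    sizeAt-copy c∈ = ∑-only FinP._≟_ proj₁ copySize (select-unique as u) c∈

    -- The induction hypothesis applies exactly to the copies that are `neither`.
    heavy? light? neither : Fin m → Bool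
    heavy? a = (4 + k) ! ≤ᵇ 3 + sizeAt a
    light? a = sizeAt a ≤ᵇ 3
    neither a = not (heavy? a) ∧ not (light? a)

    not-both : ∀ a → heavy? a ∧ light? a ≡ false
    not-both a = rich-poor ((4 + k) !) (sizeAt a) 7≤4+k!

    -- Each copy pays for its own exceptions in `mixed-bound`: a light copy has at least as many
    -- boundary edges as members, a heavy one at least as many as missing vertices. The flags are
    -- variables tied by equations, so that matching on them reduces the sum.
    classify : ∀ {a r} → (a , r) ∈ select as → ∀ h l →
      h ≡ ((4 + k) ! ≤ᵇ 3 + copySize (a , r)) → l ≡ (copySize (a , r) ≤ᵇ 3) → h ∧ l ≡ false →
      ∑ (perms r) (λ x → ⟦ h ∧ not (S (a ∷ x)) ⟧ + ⟦ l ∧ S (a ∷ x) ⟧) + ⟦ not h ∧ not l ⟧ * (12 + 8 * k)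
        ≤ copyBoundary (a , r)
    classify {a} {r} c∈ false true p q _ = begin
      copySize (a , r) + 0 ≡⟨ +-identityʳ _ ⟩
      copySize (a , r) ≤⟨ m≤n*m (copySize (a , r)) (3 + 2 * k) ⟩
      (3 + 2 * k) * copySize (a , r) ≤⟨ m≤m+n _ _ ⟩
      _ ≤⟨ light c∈ (≤ᵇ-true (sym q)) ⟩
      copyBoundary (a , r) ∎
      where open ≤-Reasoning
    classify {a} {r} c∈ false false p q _ rewrite ∑-0 (perms r) | +-identityʳ (12 + 8 * k) =
      medium c∈ (≤ᵇ-false (sym q)) (≤ᵇ-false {(4 + k) !} (sym p))
    classify {a} {r} c∈ true false p q _ = begin
      ∑ (perms r) (λ x → ⟦ not (S (a ∷ x)) ⟧ + 0) + 0 ≡⟨ trans (+-identityʳ _) (∑-cong (perms r) (λ x → +-identityʳ _)) ⟩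
      s′                                       ≤⟨ m≤n*m s′ (3 + 2 * k) ⟩
      (3 + 2 * k) * s′                         ≤⟨ m≤m+n _ _ ⟩
      (3 + 2 * k) * s′ + 2 * (1 ⊓ s′)          ≤⟨ boundary-light {k = k} r _ (copy-unique c∈) s′≤3 ⟩
      boundary r (complement (λ x → S (a ∷ x))) ≡⟨ boundary-complement r (λ x → S (a ∷ x)) (copy-unique c∈) ⟩
      copyBoundary (a , r) ∎
      where
      open ≤-Reasoning
      s′ : ℕ
      s′ = size r (complement (λ x → S (a ∷ x)))
      s′≤3 : s′ ≤ 3
      s′≤3 = +-cancelˡ-≤ (copySize (a , r)) _ _ (≤-trans (≤-reflexive (size-complement r _))
        (≤-trans (≤ᵇ-true {(4 + k) !} (sym p)) (≤-reflexive (+-comm 3 (copySize (a , r))))))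

    copy-classified : ∀ {c} → c ∈ select as →
      ∑ (perms (proj₂ c)) (λ x → ⟦ heavy? (proj₁ c) ∧ not (S (proj₁ c ∷ x)) ⟧ + ⟦ light? (proj₁ c) ∧ S (proj₁ c ∷ x) ⟧)
        + ⟦ neither (proj₁ c) ⟧ * (12 + 8 * k) ≤ copyBoundary c
    copy-classified {a , r} c∈ = classify c∈ (heavy? a) (light? a)
      (cong (λ s → (4 + k) ! ≤ᵇ 3 + s) (sizeAt-copy c∈)) (cong (_≤ᵇ 3) (sizeAt-copy c∈)) (not-both a)

    -- The exceptions in `mixed-bound` are absorbed by the boundaries inside the copies, so each
    -- pair of a heavy and a light copy counts with its full (3 + k)! edges.
    boundary-classified : (3 + k) ! * (count heavy? as * count light? as) + count neither as * (12 + 8 * k) ≤ boundary as S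
    boundary-classified = begin
      (3 + k) ! * (count heavy? as * count light? as) + count neither as * (12 + 8 * k)
        ≤⟨ +-monoˡ-≤ _ (mixed-bound as u heavy? light? not-both S) ⟩
      X₁ + ∑ (select as) spoiled + count neither as * (12 + 8 * k)
        ≡⟨ +-assoc X₁ _ _ ⟩
      X₁ + (∑ (select as) spoiled + count neither as * (12 + 8 * k))
        ≡⟨ cong (λ t → X₁ + (∑ (select as) spoiled + t)) (trans (sym (cong (_* (12 + 8 * k)) (∑-select-head as _))) (sym (∑-*ʳ (select as) _ _))) ⟩
      X₁ + (∑ (select as) spoiled + ∑ (select as) (λ c → ⟦ neither (proj₁ c) ⟧ * (12 + 8 * k)))
        ≡⟨ cong (X₁ +_) (∑-+ (select as) _ _) ⟨
      X₁ + ∑ (select as) (λ c → spoiled c + ⟦ neither (proj₁ c) ⟧ * (12 + 8 * k))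
        ≤⟨ +-monoʳ-≤ X₁ (≤-trans (∑-mono∈ (select as) copy-classified) (m≤n+m _ (crossing as S zero (fromℕ (4 + k))))) ⟩
      X₁ + (crossing as S zero (fromℕ (4 + k)) + ∑ (select as) copyBoundary)
        ≡⟨ boundary-copies ⟨
      boundary as S ∎
      where
      open ≤-Reasoning
      X₁ : ℕ
      X₁ = crossing as S zero (suc zero)
      spoiled : Fin m × Word (4 + k) → ℕ
      spoiled (a , r) = ∑ (perms r) (λ x → ⟦ heavy? a ∧ not (S (a ∷ x)) ⟧ + ⟦ light? a ∧ S (a ∷ x) ⟧)

    classes-exhaust : count heavy? as + (count light? as + count neither as) ≡ 5 + k
    classes-exhaust = trans (cong (count heavy? as +_) (sym (∑-+ (toList as) _ _)))
      (trans (sym (∑-+ (toList as) _ _)) (trans (∑-cong (toList as) (λ a → one (heavy? a) (light? a) (not-both a)))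
      (trans (∑-1 (toList as)) (VecP.length-toList as))))
      where
      one : ∀ h l → h ∧ l ≡ false → ⟦ h ⟧ + (⟦ l ⟧ + ⟦ not h ∧ not l ⟧) ≡ 1
      one true false e = refl
      one false true e = refl
      one false false e = refl

    -- Two copies that are `neither` already give 24 + 16k. Otherwise p heavy and q light copies
    -- make up all copies but at most one, and pq ≥ p + q - 1 pairs with at least 6(k + 1) edges
    -- each exceed the target.
    boundary-mixed : 1 ≤ count heavy? as → 1 ≤ count light? as → 20 + 8 * k ≤ boundary as S
    boundary-mixed 1≤p 1≤q = ≤-trans (arithmetic (count heavy? as) (count light? as) (count neither as) 1≤p 1≤q classes-exhaust)
      boundary-classified
      where
      open ≤-Reasoning
      arithmetic : ∀ p q μ → 1 ≤ p → 1 ≤ q → p + (q + μ) ≡ 5 + k → 20 + 8 * k ≤ (3 + k) ! * (p * q) + μ * (12 + 8 * k)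
      arithmetic (suc p) (suc q) μ _ _ e = go μ e
        where
        product : suc (p + q) ≤ suc p * suc q
        product = linear (p * q) (≤-refl {0}) (identity p q)
          where
          identity : ∀ p q → suc (p + q) + 0 + p * q ≡ suc p * suc q + 0
          identity = solve-∀
        scaled : ∀ {c} → c ≡ p + q → 6 * suc k * suc c ≤ (3 + k) ! * (suc p * suc q)
        scaled refl = *-mono-≤ (factorial-large k) product
        go : ∀ μ → suc p + (suc q + μ) ≡ 5 + k → 20 + 8 * k ≤ (3 + k) ! * (suc p * suc q) + μ * (12 + 8 * k)
        go 0 e = ≤-trans (linear (6 * k * k + 22 * k + 4) (≤-refl {0}) (identity k)) (≤-trans (scaled
          (+-cancelˡ-≡ 2 _ _ (trans (sym e) (shape p q)))) (m≤m+n _ _))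
          where
          identity : ∀ k → 20 + 8 * k + 0 + (6 * k * k + 22 * k + 4) ≡ 6 * suc k * suc (3 + k) + 0
          identity = solve-∀
          shape : ∀ p q → suc p + (suc q + 0) ≡ 2 + (p + q)
          shape = solve-∀
        go 1 e = ≤-trans (linear (6 * k * k + 24 * k + 10) (≤-refl {0}) (identity k)) (+-monoˡ-≤ _ (scaled
          (+-cancelˡ-≡ 3 _ _ (trans (sym e) (shape p q)))))
          where
          identity : ∀ k → 20 + 8 * k + 0 + (6 * k * k + 24 * k + 10) ≡ 6 * suc k * suc (2 + k) + 1 * (12 + 8 * k) + 0
          identity = solve-∀
          shape : ∀ p q → suc p + (suc q + 1) ≡ 3 + (p + q)
          shape = solve-∀
        go (suc (suc μ)) e = ≤-trans (linear (4 + 8 * k + μ * (12 + 8 * k)) (≤-refl {0}) (identity k μ)) (m≤n+m _ _)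
          where
          identity : ∀ k μ → 20 + 8 * k + 0 + (4 + 8 * k + μ * (12 + 8 * k)) ≡ suc (suc μ) * (12 + 8 * k) + 0
          identity = solve-∀

    unmarked : ∀ (h : Fin m → Bool) → count h as ≡ 0 → ∀ {c} → c ∈ select as → h (proj₁ c) ≡ false
    unmarked h none {c} c∈ with h (proj₁ c) in e
    ... | false = refl
    ... | true = contradiction (subst (1 ≤_) none (≤-trans (≤-reflexive (sym (cong ⟦_⟧ e)))
          (∑-member (λ a → ⟦ h a ⟧) (subst (proj₁ c ∈_) (select-keys as) (∈-map⁺ proj₁ c∈))))) λ ()

    notHeavy : count heavy? as ≡ 0 → NotHeavy
    notHeavy none c∈ = ≤ᵇ-false {(4 + k) !}
      (trans (cong (λ s → (4 + k) ! ≤ᵇ 3 + s) (sym (sizeAt-copy c∈))) (unmarked heavy? none c∈))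

    notLight : count light? as ≡ 0 → ∀ {c} → c ∈ select as → 4 ≤ copySize c
    notLight none c∈ = ≤ᵇ-false (trans (cong (_≤ᵇ 3) (sym (sizeAt-copy c∈))) (unmarked light? none c∈))

  -- Both size conditions are exchanged by passing to the complement, which keeps the boundary.
  -- Without light copies the complement has no heavy ones, so one argument serves both cases; the
  -- remaining case has copies of both kinds.
  isoperimetric : ∀ k (as : Word {m} (4 + k)) → Unique (toList as) → ∀ S → 4 ≤ size as S →
    4 + size as S ≤ (4 + k) ! → 12 + 8 * k ≤ boundary as S
  isoperimetric zero as u S lo hi = boundary₄ as S lo (+-cancelˡ-≤ 4 _ _ hi)
  isoperimetric (suc k) as u S lo hi = ≤-trans (≤-reflexive (cong (12 +_) (*-suc 8 k))) bound
    where
    open Copies (isoperimetric k) as u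
    module C = Copies (isoperimetric k) as u (complement S)
    bound : 20 + 8 * k ≤ boundary as S
    bound with count (heavy? S) as in p | count (light? S) as in q
    ... | zero | _ = boundary-notHeavy S (notHeavy S p) lo
    ... | suc _ | zero = ≤-trans (C.boundary-notHeavy sparse
            (+-cancelʳ-≤ (size as S) _ _ (≤-trans hi (≤-reflexive (trans (sym (size-complement as S)) (+-comm (size as S) _))))))
            (≤-reflexive (boundary-complement as S u))
      where
      sparse : C.NotHeavy
      sparse {c} c∈ = ≤-trans (+-monoˡ-≤ (C.copySize c) (notLight S q c∈)) (≤-reflexive (size-complement (proj₂ c) _))
    ... | suc _ | suc _ = boundary-mixed S (subst (1 ≤_) (sym p) (s≤s z≤n)) (subst (1 ≤_) (sym q) (s≤s z≤n))

-- Cuts of the faulty graph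

module _ {A : Set} where

  sieve : (A → Bool) → List A → List A
  sieve p = filter (λ x → p x Bool.≟ true)

  length-sieve : ∀ p (xs : List A) → length (sieve p xs) ≡ ∑ xs (λ x → ⟦ p x ⟧)
  length-sieve p [] = refl
  length-sieve p (x ∷ xs) with p x
  ... | true = cong suc (length-sieve p xs)
  ... | false = length-sieve p xs

-- Vertices, adjacency and degrees of BS_n

module _ {n : ℕ} where

  -- Translates between `generators`, which count positions from the end, and `Allowed`, which
  -- counts them from the beginning.
  mirror : V n → V n
  mirror x = tabulate (λ i → lookup x (opposite i))

  lookup-mirror : ∀ x i → lookup (mirror x) i ≡ lookup x (opposite i)
  lookup-mirror x i = lookup∘tabulate _ i

  mirror-involutive : ∀ x → mirror (mirror x) ≡ x
  mirror-involutive x = vec-ext λ i → trans (lookup-mirror (mirror x) i)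
    (trans (lookup-mirror x (opposite i)) (cong (lookup x) (FinP.opposite-involutive i)))

  mirror-injective : ∀ x y → mirror x ≡ mirror y → x ≡ y
  mirror-injective x y e = trans (sym (mirror-involutive x)) (trans (cong mirror e) (mirror-involutive y))

  opposite-injective : ∀ {i j : Fin n} → opposite i ≡ opposite j → i ≡ j
  opposite-injective {i} {j} e =
    trans (sym (FinP.opposite-involutive i)) (trans (cong opposite e) (FinP.opposite-involutive j))

  mirror-IsPerm : ∀ x → IsPerm x → IsPerm (mirror x)
  mirror-IsPerm x d i j e = opposite-injective (d _ _ (trans (sym (lookup-mirror x i)) (trans e (lookup-mirror x j))))

  mirror-swap : ∀ x i j → mirror (swapAt x i j) ≡ swap (mirror x) (opposite j) (opposite i)
  mirror-swap x i j = vec-ext λ k → trans (lookup-mirror (swapAt x i j) k) (at k)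
    where
    oo = FinP.opposite-involutive
    at : ∀ k → lookup (swapAt x i j) (opposite k) ≡ lookup (swap (mirror x) (opposite j) (opposite i)) k
    at k with k Fin.≟ opposite i | k Fin.≟ opposite j
    ... | yes refl | _ = trans (cong (lookup (swapAt x i j)) (oo i)) (trans (lookup-swapAtˡ x i j)
            (trans (cong (lookup x) (sym (oo j))) (trans (sym (lookup-mirror x (opposite j)))
            (sym (lookup-swapAtʳ (mirror x) (opposite j) (opposite i))))))
    ... | no _ | yes refl = trans (cong (lookup (swapAt x i j)) (oo j)) (trans (lookup-swapAtʳ x i j)
            (trans (cong (lookup x) (sym (oo i))) (trans (sym (lookup-mirror x (opposite i)))
            (sym (lookup-swapAtˡ (mirror x) (opposite j) (opposite i))))))
    ... | no k≢i | no k≢j = trans (lookup-swapAt-other x (avoid k≢i) (avoid k≢j))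
            (trans (sym (lookup-mirror x k)) (sym (lookup-swapAt-other (mirror x) k≢j k≢i)))
      where
      avoid : ∀ {k l} → k ≢ opposite l → opposite k ≢ l
      avoid ne refl = ne (sym (oo _))

  allFin-unique : Unique (toList (Vec.allFin n))
  allFin-unique = distinct⇒unique λ i j e → trans (sym (lookup-allFin i)) (trans e (lookup-allFin j))

  -- Pigeonhole: n distinct letters exhaust an alphabet of n letters, so the remainder of the
  -- splitting is empty.
  IsPerm⇒∈perms : ∀ {x : V n} → IsPerm x → x ∈ perms (Vec.allFin n)
  IsPerm⇒∈perms {x} d with unique-⊆⇒↭++ {ys = toList x} {xs = toList (Vec.allFin n)} (distinct⇒unique d)
      (λ {a} _ → subst (_∈ toList (Vec.allFin n)) (lookup-allFin a) (lookup-∈ (Vec.allFin n) a))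
  ... | [] , p = ↭-perms (Vec.allFin n) (↭-sym (subst (toList (Vec.allFin n) ↭_) (++-identityʳ (toList x)) p))
  ... | z ∷ zs , p = contradiction (trans (sym (length-toList (Vec.allFin n))) (trans (↭-length p) (length-++ (toList x))))
        (λ e → m≢1+m+n n (trans e (trans (cong (_+ suc (length zs)) (length-toList x)) (+-suc n _))))

  ∈perms⇒IsPerm : ∀ {x} → x ∈ perms (Vec.allFin n) → IsPerm x
  ∈perms⇒IsPerm m = perms-distinct (Vec.allFin n) allFin-unique m

  vertices : List (V n)
  vertices = map mirror (perms (Vec.allFin n))

  vertices-unique : Unique vertices
  vertices-unique = map⁺ (λ {x} {y} → mirror-injective x y) (perms-unique (Vec.allFin n) allFin-unique)

  ∈-vertices : ∀ {x} → IsPerm x → x ∈ vertices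
  ∈-vertices {x} d = subst (_∈ vertices) (mirror-involutive x) (∈-map⁺ mirror (IsPerm⇒∈perms {mirror x} (mirror-IsPerm x d)))

  vertex-IsPerm : ∀ {x} → x ∈ vertices → IsPerm x
  vertex-IsPerm m with ∈-map⁻ mirror m
  ... | w , w∈ , refl = mirror-IsPerm w (∈perms⇒IsPerm w∈)

  allowed-< : ∀ {i j : Fin n} → Allowed i j → toℕ i < toℕ j
  allowed-< (inj₁ e) = ≤-reflexive (sym e)
  allowed-< (inj₂ (i≡0 , 0<j)) rewrite i≡0 = 0<j

  Adj-sym : ∀ {x y : V n} → Adj x y → Adj y x
  Adj-sym {x} (x≢y , i , j , a , refl) = (λ e → x≢y (sym e)) , i , j , a , sym (swapAt-involutive x i j)

  Adj-~ : ∀ {x y : V n} → Adj x y → x ~ y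
  Adj-~ {x} (_ , i , j , a , refl) = ~-swapAt x i j (allowed-< a)

  Adj-IsPerm : ∀ {x y : V n} → Adj x y → IsPerm x → IsPerm y
  Adj-IsPerm a d = unique⇒distinct (~-unique (Adj-~ a) (distinct⇒unique d))

  Adj-parity : ∀ {x y : V n} → Adj x y → IsPerm x → parity y ≡ not (parity x)
  Adj-parity a d = parity-~ (distinct⇒unique d) (Adj-~ a)

  Adj? : ∀ (x y : V n) → Dec (Adj x y)
  Adj? x y = ¬? (x ≟V y) ×-dec FinP.any? λ i → FinP.any? λ j → Allowed? i j ×-dec (y ≟V swap x i j)

  swap-Adj : ∀ {x : V n} → IsPerm x → ∀ {i j} → Allowed i j → Adj x (swap x i j)
  swap-Adj {x} d {i} {j} a =
    (λ e → <⇒≢ (allowed-< a) (cong toℕ (d i j (trans (cong (λ y → lookup y i) e) (lookup-swapAtˡ x i j)))))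
    , i , j , a , refl

  ∈-gens : ∀ {i j : Fin n} → Allowed i j → (i , j) ∈ gens n
  ∈-gens {i} {j} a = ∈-filter⁺ (λ p → Allowed? (proj₁ p) (proj₂ p)) (∈-cartesianProduct⁺ (∈-allFin i) (∈-allFin j)) a

  EdgeIn-sym : ∀ {F : List (Edge n)} {x y} → EdgeIn F x y → EdgeIn F y x
  EdgeIn-sym (inj₁ m) = inj₂ m
  EdgeIn-sym (inj₂ m) = inj₁ m

  module _ (F : List (Edge n)) where

    private
      images : V n → List (V n)
      images x = map (λ p → swap x (proj₁ p) (proj₂ p)) (gens n)

    ∈-neighbours⁺ : ∀ {x y} → Adj x y → ¬ EdgeIn F x y → y ∈ neighbours F x
    ∈-neighbours⁺ {x} (x≢y , i , j , a , refl) ¬F = ∈-deduplicate⁺ _≟V_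
      (∈-filter⁺ (λ y → ¬? (x ≟V y)) (∈-filter⁺ (λ y → ¬? (EdgeIn? F x y))
        (∈-map⁺ (λ p → swap x (proj₁ p) (proj₂ p)) (∈-gens a)) ¬F) x≢y)

    ∈-neighbours⁻ : ∀ {x y} → y ∈ neighbours F x → Adj x y × ¬ EdgeIn F x y
    ∈-neighbours⁻ {x} {y} m
      with m₁ , x≢y ← ∈-filter⁻ (λ y → ¬? (x ≟V y)) {xs = filter (λ y → ¬? (EdgeIn? F x y)) (images x)} (∈-deduplicate⁻ _≟V_ _ m)
      with m₂ , ¬F ← ∈-filter⁻ (λ y → ¬? (EdgeIn? F x y)) {xs = images x} m₁
      with (i , j) , g , refl ← ∈-map⁻ (λ p → swap x (proj₁ p) (proj₂ p)) m₂
      with _ , a ← ∈-filter⁻ (λ p → Allowed? (proj₁ p) (proj₂ p)) {xs = Data.List.cartesianProduct (allFin n) (allFin n)} g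
      = (x≢y , i , j , a , refl) , ¬F

    neighbours-unique : ∀ x → Unique (neighbours F x)
    neighbours-unique x = deduplicate-! _≟V_ _

    deg≥ : ∀ {x ys} → Unique ys → (∀ {y} → y ∈ ys → Adj x y × ¬ EdgeIn F x y) → length ys ≤ deg F x
    deg≥ u h = length-⊆ u (λ m → let a , ¬F = h m in ∈-neighbours⁺ a ¬F)

-- The pair of positions 0 and 1 is of both kinds; it is listed among the adjacent pairs only, which
-- leaves 2n - 3 entries for n = 2 + m.
allowedPairs : ∀ m → List (Fin (2 + m) × Fin (2 + m))
allowedPairs m = map (λ i → inject₁ i , suc i) (allFin (1 + m)) ++ map (λ j → zero , suc (suc j)) (allFin m)

length-allowedPairs : ∀ m → length (allowedPairs m) ≡ 1 + 2 * m
length-allowedPairs m = trans (length-++ (map (λ i → inject₁ i , suc i) (allFin (1 + m))))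
  (trans (cong₂ _+_ (trans (length-map _ (allFin (1 + m))) (length-tabulate {n = 1 + m} (λ i → i)))
    (trans (length-map _ (allFin m)) (length-tabulate {n = m} (λ i → i))))
  (cong (λ z → suc (m + z)) (sym (+-identityʳ m))))

allowedPairs-complete : ∀ m {i j} → Allowed i j → (i , j) ∈ allowedPairs m
allowedPairs-complete m {i} {suc j} (inj₁ e) = ∈-++⁺ˡ (subst (λ i → (i , suc j) ∈ _)
  (FinP.toℕ-injective (trans (FinP.toℕ-inject₁ j) (suc-injective e))) (∈-map⁺ (λ i → inject₁ i , suc i) (∈-allFin j)))
allowedPairs-complete m {zero} {suc zero} (inj₂ _) = ∈-++⁺ˡ (∈-map⁺ (λ i → inject₁ i , suc i) (∈-allFin zero))
allowedPairs-complete m {zero} {suc (suc j)} (inj₂ _) =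
  ∈-++⁺ʳ (map (λ i → inject₁ i , suc i) (allFin (1 + m))) (∈-map⁺ (λ j → zero , suc (suc j)) (∈-allFin j))

deg≤ : ∀ {m} (F : List (Edge (2 + m))) x → deg F x ≤ 1 + 2 * m
deg≤ {m} F x = subst (deg F x ≤_) (trans (length-map _ (allowedPairs m)) (length-allowedPairs m))
  (length-⊆ (neighbours-unique F x) λ n → image (proj₁ (∈-neighbours⁻ F n)))
  where
  image : ∀ {y} → Adj x y → y ∈ map (λ p → swap x (proj₁ p) (proj₂ p)) (allowedPairs m)
  image (_ , i , j , a , refl) = ∈-map⁺ (λ p → swap x (proj₁ p) (proj₂ p)) (allowedPairs-complete m a)

generators-shape : ∀ n {i j} → (i , j) ∈ generators n → toℕ j ≡ suc (toℕ i) ⊎ suc (toℕ j) ≡ n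
generators-shape 2 (here refl) = inj₁ refl
generators-shape (suc (suc (suc n))) (here refl) = inj₁ refl
generators-shape (suc (suc (suc n))) (there (here refl)) = inj₂ (cong suc (FinP.toℕ-fromℕ (suc (suc n))))
generators-shape (suc (suc (suc n))) (there (there m)) with ∈-map⁻ _ m
... | (i , j) , g , refl with generators-shape (suc (suc n)) g
...   | inj₁ e = inj₁ (cong suc e)
...   | inj₂ e = inj₂ (cong suc e)

generators-allowed : ∀ n {i j} → (i , j) ∈ generators n → Allowed (opposite j) (opposite i)
generators-allowed n {i} {j} g with generators-shape n g
... | inj₁ e = inj₁ (trans (FinP.opposite-prop i) (trans (sym (cong (n ∸_) e))
      (trans (∸-suc′ (FinP.toℕ<n j)) (cong suc (sym (FinP.opposite-prop j))))))
  where
  ∸-suc′ : ∀ {a n} → a < n → n ∸ a ≡ suc (n ∸ suc a)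
  ∸-suc′ {zero} {suc n} _ = refl
  ∸-suc′ {suc a} {suc n} (s≤s h) = ∸-suc′ h
... | inj₂ e = inj₂ (trans (FinP.opposite-prop j) (trans (cong (n ∸_) e) (n∸n≡0 n)) ,
      subst (0 <_) (sym (FinP.opposite-prop i)) (m<n⇒0<n∸m (≤-<-trans (generators-< n g) (FinP.toℕ<n j))))

-- Lower bounds for cuts after faults, and the path system

module FaultyGraph {k : ℕ} (F : List (Edge (4 + k))) (F≤ : length F ≤ 6 * (4 + k) ∸ 17)
  (δ≥2 : MinDeg≥2 F) where

  n : ℕ
  n = 4 + k

  vs : List (V n)
  vs = vertices

  -- `V n` also contains words with repeated letters; membership in `vs` keeps to the permutations.
  H : V n → V n → Set
  H x y = x ∈ vs × Adj x y × ¬ EdgeIn F x y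

  H? : ∀ x y → Dec (H x y)
  H? x y = ∈?-dec _≟V_ x vs ×-dec (Adj? x y ×-dec ¬? (EdgeIn? F x y))

  H-target : ∀ {x y} → H x y → y ∈ vs
  H-target (m , a , _) = ∈-vertices (Adj-IsPerm a (vertex-IsPerm m))

  H-sym : ∀ {x y} → H x y → H y x
  H-sym h@(m , a , ¬F) = H-target h , Adj-sym a , λ e → ¬F (EdgeIn-sym {F = F} e)

  sizeᵛ : (V n → Bool) → ℕ
  sizeᵛ S = ∑ vs (λ x → ⟦ S x ⟧)

  crosses : (V n → Bool) → V n × V n → Bool
  crosses S (x , y) = S x ∧ not (S y)

  crosses⁻ : ∀ S {x y} → crosses S (x , y) ≡ true → S x ≡ true × S y ≡ false
  crosses⁻ S {x} {y} e with S x | S y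
  ... | true | false = refl , refl

  arcsFrom liveFrom : V n → List (V n × V n)
  liveFrom x = map (x ,_) (neighbours F x)
  arcsFrom w = map (λ g → mirror w , mirror (act w g)) (generators n)

  -- `liveArcs` comes from `neighbours`, so that it adds up to degrees; `allArcs` comes from
  -- `generators`, so that it adds up to `boundary`.
  liveArcs allArcs : List (V n × V n)
  liveArcs = concatMap liveFrom vs
  allArcs = concatMap arcsFrom (perms (Vec.allFin n))

  liveArcs-unique : Unique liveArcs
  liveArcs-unique = unique-concatMap proj₁ (λ x → x) vertices-unique
    (λ {x} _ → map⁺ (λ { refl → refl }) (neighbours-unique F x))
    (λ {x} _ m → source (∈-map⁻ (x ,_) m))
    where
    source : ∀ {x : V n} {a : V n × V n} → (∃ λ y → y ∈ neighbours F x × a ≡ (x , y)) → proj₁ a ≡ x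
    source (_ , _ , refl) = refl

  liveArcs⁻ : ∀ {x y} → (x , y) ∈ liveArcs → H x y
  liveArcs⁻ m with find (∈-concatMap⁻ liveFrom {xs = vs} m)
  ... | x , x∈ , m′ with ∈-map⁻ (x ,_) m′
  ...   | y , y∈ , refl = x∈ , ∈-neighbours⁻ F y∈

  liveArcs⁺ : ∀ {x y} → H x y → (x , y) ∈ liveArcs
  liveArcs⁺ {x} (x∈ , a , ¬F) = ∈-concatMap⁺ liveFrom (lose x∈ (∈-map⁺ (x ,_) (∈-neighbours⁺ F a ¬F)))

  cutArcs : (V n → Bool) → List (V n × V n)
  cutArcs S = sieve (crosses S) liveArcs

  cutArcs⁻ : ∀ S {x y} → (x , y) ∈ cutArcs S → H x y × S x ≡ true × S y ≡ false
  cutArcs⁻ S m = let m′ , e = ∈-filter⁻ (λ a → crosses S a Bool.≟ true) {xs = liveArcs} m in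
    liveArcs⁻ m′ , crosses⁻ S e

  cutArcs-unique : ∀ S → Unique (cutArcs S)
  cutArcs-unique S = filter⁺ (λ a → crosses S a Bool.≟ true) liveArcs-unique

  length-cutArcs : ∀ S → length (cutArcs S) ≡ ∑ vs (λ x → ∑ (neighbours F x) (λ y → ⟦ S x ∧ not (S y) ⟧))
  length-cutArcs S = trans (length-sieve (crosses S) liveArcs) (trans (∑-concatMap vs liveFrom _)
    (∑-cong vs (λ x → ∑-map (neighbours F x) (x ,_) _)))

  degree-sum : ∀ S → ∑ vs (λ x → ⟦ S x ⟧ * deg F x) ≡
    length (cutArcs S) + ∑ vs (λ x → ⟦ S x ⟧ * ∑ (neighbours F x) (λ y → ⟦ S y ⟧))
  degree-sum S = trans (∑-cong vs at) (trans (∑-+ vs _ _)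
    (cong (_+ ∑ vs (λ x → ⟦ S x ⟧ * ∑ (neighbours F x) (λ y → ⟦ S y ⟧))) (sym (length-cutArcs S))))
    where
    split : ∀ s t → ⟦ s ⟧ * 1 ≡ ⟦ s ∧ not t ⟧ + ⟦ s ⟧ * ⟦ t ⟧
    split true true = refl
    split true false = refl
    split false t = refl
    at : ∀ x → ⟦ S x ⟧ * deg F x ≡
      ∑ (neighbours F x) (λ y → ⟦ S x ∧ not (S y) ⟧) + ⟦ S x ⟧ * ∑ (neighbours F x) (λ y → ⟦ S y ⟧)
    at x = trans (cong (⟦ S x ⟧ *_) (sym (∑-1 (neighbours F x)))) (trans (sym (∑-*ˡ (neighbours F x) ⟦ S x ⟧ _))
      (trans (∑-cong (neighbours F x) (λ y → split (S x) (S y))) (trans (∑-+ (neighbours F x) _ _)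
      (cong (∑ (neighbours F x) (λ y → ⟦ S x ∧ not (S y) ⟧) +_) (∑-*ˡ (neighbours F x) ⟦ S x ⟧ _)))))

  -- The degree sum over `S` is at least deg u + 2(s - 1) for s members, and the at most s - 1 inner
  -- edges take back no more than 2(s - 1).
  small-cut : ∀ S {u} → IsPerm u → S u ≡ true → sizeᵛ S ≤ 3 → deg F u ≤ length (cutArcs S)
  small-cut S {u} du Su s≤3 = linear 0
    (+-mono-≤ degrees (+-mono-≤ inner sparse))
    (identity (deg F u) (length (cutArcs S)) (∑ vs (λ x → ⟦ S x ⟧ * ∑ (neighbours F x) (λ y → ⟦ S y ⟧)))
      (p * q) (p + q))
    where
    p q rest : ℕ
    p = ∑ vs (λ x → ⟦ S x ∧ parity x ⟧)
    q = ∑ vs (λ x → ⟦ S x ∧ not (parity x) ⟧)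
    size-split : sizeᵛ S ≡ p + q
    size-split = trans (∑-cong vs (λ x → ⟦⟧-split (S x) (parity x))) (∑-+ vs _ _)
    rest = ∑ vs (except _≟V_ (λ x → x) u (λ x → ⟦ S x ⟧))
    pick : ∀ f → ∑ vs f ≡ f u + ∑ vs (except _≟V_ (λ x → x) u f)
    pick f = ∑-pick _≟V_ (λ x → x) f vertices-unique (∈-vertices du)
    size-rest : p + q ≡ 1 + rest
    size-rest = trans (sym size-split) (trans (pick (λ x → ⟦ S x ⟧)) (cong (λ b → ⟦ b ⟧ + rest) Su))
    others′ : V n → ℕ
    others′ = except _≟V_ (λ x → x) u (λ x → ⟦ S x ⟧ * deg F x)
    others : 2 * rest ≤ ∑ vs (others′)
    others = ≤-trans (≤-reflexive (sym (∑-*ˡ vs 2 _))) (∑-mono∈ vs (λ {x} m → one x m))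
      where
      one : ∀ x → x ∈ vs → 2 * except _≟V_ (λ x → x) u (λ x → ⟦ S x ⟧) x ≤ except _≟V_ (λ x → x) u (λ x → ⟦ S x ⟧ * deg F x) x
      one x m with does (x ≟V u) | S x
      ... | true | _ = z≤n
      ... | false | false = z≤n
      ... | false | true = ≤-trans (δ≥2 x (vertex-IsPerm m)) (m≤m+n _ 0)
    degrees : deg F u + 2 * (p + q) ≤ 2 + (length (cutArcs S) + ∑ vs (λ x → ⟦ S x ⟧ * ∑ (neighbours F x) (λ y → ⟦ S y ⟧)))
    degrees = begin
      deg F u + 2 * (p + q)     ≡⟨ cong (λ s → deg F u + 2 * s) size-rest ⟩
      deg F u + 2 * (1 + rest)  ≡⟨ shuffle (deg F u) rest ⟩
      2 + (1 * deg F u + 2 * rest) ≤⟨ +-monoʳ-≤ 2 (+-monoʳ-≤ (1 * deg F u) others) ⟩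
      2 + (1 * deg F u + ∑ vs others′) ≡⟨ cong (λ b → 2 + (⟦ b ⟧ * deg F u + ∑ vs others′)) (sym Su) ⟩
      2 + (⟦ S u ⟧ * deg F u + ∑ vs others′) ≡⟨ cong (2 +_) (trans (sym (pick (λ x → ⟦ S x ⟧ * deg F x))) (degree-sum S)) ⟩
      _ ∎
      where
      open ≤-Reasoning
      shuffle : ∀ d r → d + 2 * (1 + r) ≡ 2 + (1 * d + 2 * r)
      shuffle = solve-∀
    inner : ∑ vs (λ x → ⟦ S x ⟧ * ∑ (neighbours F x) (λ y → ⟦ S y ⟧)) ≤ 2 * (p * q)
    inner = bipartite-bound parity S vs (neighbours F) (λ {x} _ → neighbours-unique F x)
      (λ m m′ → H-target (m , ∈-neighbours⁻ F m′))
      (λ m m′ → Adj-parity (proj₁ (∈-neighbours⁻ F m′)) (vertex-IsPerm m))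
    sparse : 2 * (p * q) + 2 ≤ 2 * (p + q)
    sparse = subst (λ e → 2 * (p * q) + 2 * e ≤ 2 * (p + q)) (cong (1 ⊓_) size-rest)
      (bipartite-sparse p q (subst (_≤ 3) size-split s≤3))
    identity : ∀ d c i r s → d + (2 + (c + i) + (2 * r + 2 * s)) + 0 ≡ c + (d + 2 * s + (i + (2 * r + 2)))
    identity = solve-∀

  -- In terms of k the count is (12 + 8k) - (7 + 6k) = 5 + 2k, the largest degree possible.
  middle-cut : ∀ S → 4 ≤ sizeᵛ S → 4 + sizeᵛ S ≤ n ! → ∀ x → deg F x ≤ length (cutArcs S)
  middle-cut S lo hi x = ≤-trans (deg≤ F x) (linear 0 (+-mono-≤ boundary≤ (+-mono-≤ iso (subst (length F ≤_) (bound k) F≤)))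
    (identity k (length (cutArcs S)) (length F) (boundary as (λ w → S (mirror w)))))
    where
    as = Vec.allFin n
    size≡ : sizeᵛ S ≡ size as (λ w → S (mirror w))
    size≡ = ∑-map (perms as) mirror _
    iso : 12 + 8 * k ≤ boundary as (λ w → S (mirror w))
    iso = isoperimetric k as allFin-unique _ (subst (4 ≤_) size≡ lo) (subst (λ s → 4 + s ≤ n !) size≡ hi)
    bound : ∀ k → 6 * (4 + k) ∸ 17 ≡ 7 + 6 * k
    bound k = cong (_∸ 17) (*-distribˡ-+ 6 4 k)
    identity : ∀ k c f b → 1 + 2 * (2 + k) + (c + f + (b + (7 + 6 * k))) + 0 ≡ c + (b + (12 + 8 * k + f))
    identity = solve-∀
    crossing-arcs dead live : List (V n × V n)
    crossing-arcs = sieve (crosses S) allArcs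
    dead = filter (λ a → EdgeIn? F (proj₁ a) (proj₂ a)) crossing-arcs
    live = filter (λ a → ¬? (EdgeIn? F (proj₁ a) (proj₂ a))) crossing-arcs
    boundary≡ : boundary as (λ w → S (mirror w)) ≡ length crossing-arcs
    boundary≡ = sym (trans (length-sieve (crosses S) allArcs) (trans (∑-concatMap (perms as) arcsFrom _)
      (∑-cong (perms as) (λ w → ∑-map (generators n) (λ g → mirror w , mirror (act w g)) (λ a → ⟦ crosses S a ⟧)))))
    arc-shape : ∀ {a} → a ∈ allArcs → ∃ λ w → w ∈ perms as × ∃ λ g → g ∈ generators n × a ≡ (mirror w , mirror (act w g))
    arc-shape m with find (∈-concatMap⁻ arcsFrom {xs = perms as} m)
    ... | w , w∈ , m′ with ∈-map⁻ (λ g → mirror w , mirror (act w g)) m′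
    ...   | g , g∈ , e = w , w∈ , g , g∈ , e
    allArcs-unique : Unique allArcs
    allArcs-unique = unique-concatMap proj₁ mirror
      (AllPairs.map (λ {x} {y} ne e → ne (mirror-injective x y e)) (perms-unique as allFin-unique))
      (λ {w} w∈ → unique-map (λ {g} {h} g∈ h∈ e → swapAt-injective w (∈perms⇒IsPerm w∈)
        (generators-< n g∈) (generators-< n h∈) (mirror-injective (act w g) (act w h) (cong proj₂ e))) (generators-unique n))
      (λ {w} _ m → source w (∈-map⁻ (λ g → mirror w , mirror (act w g)) m))
      where
      source : ∀ (w : V n) {a : V n × V n} → (∃ λ g → g ∈ generators n × a ≡ (mirror w , mirror (act w g))) → proj₁ a ≡ mirror w
      source w (_ , _ , refl) = refl
    arc-Adj : ∀ {x y} → (x , y) ∈ allArcs → x ∈ vs × Adj x y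
    arc-Adj m with arc-shape m
    ... | w , w∈ , (i , j) , g∈ , refl = ∈-map⁺ mirror w∈ ,
          subst (Adj (mirror w)) (sym (mirror-swap w i j))
            (swap-Adj (mirror-IsPerm w (∈perms⇒IsPerm w∈)) (generators-allowed n g∈))
    crossing-unique : Unique crossing-arcs
    crossing-unique = filter⁺ (λ a → crosses S a Bool.≟ true) allArcs-unique
    crossing⁻ : ∀ {x y} → (x , y) ∈ crossing-arcs → (x , y) ∈ allArcs × crosses S (x , y) ≡ true
    crossing⁻ m = ∈-filter⁻ (λ a → crosses S a Bool.≟ true) {xs = allArcs} m
    live≤ : length live ≤ length (cutArcs S)
    live≤ = length-⊆ (filter⁺ _ crossing-unique) λ m →
      let m′ , ¬F = ∈-filter⁻ (λ a → ¬? (EdgeIn? F (proj₁ a) (proj₂ a))) {xs = crossing-arcs} m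
          m″ , e = crossing⁻ m′
          x∈ , a = arc-Adj m″
      in ∈-filter⁺ (λ a → crosses S a Bool.≟ true) (liveArcs⁺ (x∈ , a , ¬F)) e
    -- A fault may be recorded in either direction; `orient` chooses a recorded one. It is injective
    -- on `dead`, since all arcs there leave `S` and none is the reverse of another.
    orient : V n × V n → V n × V n
    orient (x , y) = if does (∈?-dec _≟E_ (x , y) F) then (x , y) else (y , x)
    orient-∈ : ∀ {x y} → EdgeIn F x y → orient (x , y) ∈ F
    orient-∈ {x} {y} e with ∈?-dec _≟E_ (x , y) F
    ... | yes m = m
    orient-∈ (inj₁ m) | no ∉ = contradiction m ∉
    orient-∈ (inj₂ m) | no ∉ = m
    orient-injective : ∀ {a b} → a ∈ dead → b ∈ dead → orient a ≡ orient b → a ≡ b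
    orient-injective {x , y} {z , t} m m′ e
      with Sx , Sy ← crosses⁻ S (proj₂ (crossing⁻ (proj₁ (∈-filter⁻ (λ a → EdgeIn? F (proj₁ a) (proj₂ a)) {xs = crossing-arcs} m))))
      with Sz , St ← crosses⁻ S (proj₂ (crossing⁻ (proj₁ (∈-filter⁻ (λ a → EdgeIn? F (proj₁ a) (proj₂ a)) {xs = crossing-arcs} m′))))
      with does (∈?-dec _≟E_ (x , y) F) | does (∈?-dec _≟E_ (z , t) F)
    ... | true | true = e
    ... | false | false = cong₂ _,_ (cong proj₂ e) (cong proj₁ e)
    ... | true | false = contradiction (trans (sym Sx) (trans (cong S (cong proj₁ e)) St)) λ ()
    ... | false | true = contradiction (trans (sym Sx) (trans (cong S (cong proj₂ e)) St)) λ ()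
    dead≤ : length dead ≤ length F
    dead≤ = subst (_≤ length F) (length-map orient dead)
      (length-⊆ (unique-map orient-injective (filter⁺ _ crossing-unique)) λ m → image (∈-map⁻ orient m))
      where
      image : ∀ {e} → (∃ λ a → a ∈ dead × e ≡ orient a) → e ∈ F
      image (a , m , refl) = orient-∈ (proj₂ (∈-filter⁻ (λ a → EdgeIn? F (proj₁ a) (proj₂ a)) {xs = crossing-arcs} m))
    length-filter-split : ∀ xs → length xs ≡
      length (filter (λ a → ¬? (EdgeIn? F (proj₁ a) (proj₂ a))) xs) + length (filter (λ a → EdgeIn? F (proj₁ a) (proj₂ a)) xs)
    length-filter-split [] = refl
    length-filter-split (a ∷ xs) with does (EdgeIn? F (proj₁ a) (proj₂ a))
    ... | true = trans (cong suc (length-filter-split xs)) (sym (+-suc _ _))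
    ... | false = cong suc (length-filter-split xs)
    boundary≤ : boundary as (λ w → S (mirror w)) ≤ length (cutArcs S) + length F
    boundary≤ = ≤-trans (≤-reflexive (trans boundary≡ (length-filter-split crossing-arcs))) (+-mono-≤ live≤ dead≤)

  module _ {u v : V n} (du : IsPerm u) (dv : IsPerm v) (u≢v : u ≢ v) where

    open Menger _≟V_ H H? H-sym vs H-target u v u≢v

    -- The minimum of the degrees is what both small sides can guarantee: a small side of `u` gives
    -- deg u, and a small side of `v` gives deg v, with the arcs of the complement reversed.
    cut : Cut (deg F u ⊓ deg F v)
    cut S Su Sv with sizeᵛ S ≤? 3 | sizeᵛ (λ x → not (S x)) ≤? 3
    ... | yes s≤3 | _ = cutArcs S , cutArcs-unique S , cutArcs⁻ S , ≤-trans (m⊓n≤m (deg F u) _) (small-cut S du Su s≤3)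
    ... | no _ | yes s≤3 = map flip (cutArcs S′) , map⁺ (λ { refl → refl }) (cutArcs-unique S′) ,
          (λ m → back (∈-map⁻ flip m)) ,
          ≤-trans (m⊓n≤n (deg F u) _) (≤-trans (small-cut S′ dv (cong not Sv) s≤3)
            (≤-reflexive (sym (length-map flip (cutArcs S′)))))
      where
      S′ : V n → Bool
      S′ x = not (S x)
      flip : V n × V n → V n × V n
      flip (x , y) = y , x
      back : ∀ {x y} → (∃ λ a → a ∈ cutArcs S′ × (x , y) ≡ flip a) → H x y × S x ≡ true × S y ≡ false
      back ((y , x) , m , refl) = let h , S′y , S′x = cutArcs⁻ S′ m in
        H-sym h , trans (sym (not-involutive (S x))) (cong not S′x) , trans (sym (not-involutive (S y))) (cong not S′y)
    ... | no s≰3 | no s′≰3 = cutArcs S , cutArcs-unique S , cutArcs⁻ S ,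
          ≤-trans (m⊓n≤m (deg F u) _) (middle-cut S (≰⇒> s≰3)
            (≤-trans (+-monoˡ-≤ (sizeᵛ S) (≰⇒> s′≰3)) (≤-reflexive total)) u)
      where
      total : sizeᵛ (λ x → not (S x)) + sizeᵛ S ≡ n !
      total = trans (+-comm _ (sizeᵛ S)) (trans (cong₂ _+_ (∑-map (perms (Vec.allFin n)) mirror _) (∑-map (perms (Vec.allFin n)) mirror _))
        (size-complement (Vec.allFin n) (λ w → S (mirror w))))

    edgesOf≡arcs : ∀ (p : List (V n)) → edgesOf p ≡ arcs p
    edgesOf≡arcs [] = refl
    edgesOf≡arcs (_ ∷ []) = refl
    edgesOf≡arcs (a ∷ b ∷ p) = cong ((a , b) ∷_) (edgesOf≡arcs (b ∷ p))

    route⇒walk : ∀ {x y p} → Route H x y p → Walk F x y p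
    route⇒walk here = here
    route⇒walk (step (_ , a , ¬F) r) = step a ¬F (route⇒walk r)

    disjoint⇒EdgeDisjoint : ∀ {p q : List (V n)} → disjoint p q → EdgeDisjoint p q
    disjoint⇒EdgeDisjoint {p} {q} d (a , b) (c , e) m m′ same
      rewrite edgesOf≡arcs p | edgesOf≡arcs q with same
    ... | inj₁ (refl , refl) = proj₁ (d m) m′
    ... | inj₂ (refl , refl) = proj₂ (d m) m′

    edge-disjoint-paths : Σ (List (List (V n))) λ ps →
      length ps ≡ deg F u ⊓ deg F v × All (IsPath F u v) ps × AllPairs EdgeDisjoint ps
    edge-disjoint-paths = let ps , len , paths , dis = menger cut in
      ps , len , All.map (λ (r , uq) → route⇒walk r , uq) paths , AllPairs.map disjoint⇒EdgeDisjoint dis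

  stronglyMenger : StronglyMengerEdge F
  stronglyMenger u v = edge-disjoint-paths

-- Sharpness

allPairs-from : ∀ {A : Set} {R : A → A → Set} {xs} → Unique xs →
  (∀ {x y} → x ∈ xs → y ∈ xs → x ≢ y → R x y) → AllPairs R xs
allPairs-from [] h = []
allPairs-from (p ∷ u) h = All.tabulate (λ m → h (here refl) (there m) (All.lookup p m)) ∷
  allPairs-from u (λ m m′ → h (there m) (there m′))

allowedPairs-sound : ∀ m {i j} → (i , j) ∈ allowedPairs m → Allowed i j
allowedPairs-sound m p with ∈-++⁻ (map (λ i → inject₁ i , suc i) (allFin (1 + m))) p
... | inj₁ q with ∈-map⁻ (λ i → inject₁ i , suc i) q
...   | i , _ , refl = inj₁ (cong suc (sym (FinP.toℕ-inject₁ i)))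
allowedPairs-sound m p | inj₂ q with ∈-map⁻ (λ j → zero , suc (suc j)) q
...   | j , _ , refl = inj₂ (refl , s≤s z≤n)

allowedPairs-unique : ∀ m → Unique (allowedPairs m)
allowedPairs-unique m = ++⁺ (map⁺ (λ { refl → refl }) (allFin⁺ (1 + m))) (map⁺ (λ { refl → refl }) (allFin⁺ m))
  λ (p , q) → clash (∈-map⁻ (λ i → inject₁ i , suc i) p) (∈-map⁻ (λ j → zero , suc (suc j)) q)
  where
  clash : ∀ {g} → (∃ λ i → i ∈ allFin (1 + m) × g ≡ (inject₁ i , suc i)) →
    (∃ λ j → j ∈ allFin m × g ≡ (zero , suc (suc j))) → ⊥
  clash (zero , _ , refl) (_ , _ , ())
  clash (suc i , _ , refl) (_ , _ , ())

module Sharp (k : ℕ) where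

  n : ℕ
  n = 4 + k

  0F 1F 2F 3F : Fin n
  0F = zero
  1F = suc zero
  2F = suc (suc zero)
  3F = suc (suc (suc zero))

  -- The 4-cycle arises from the commuting swaps of positions 0, 1 and of positions 2, 3. In `far`
  -- the two pairs of letters have changed places, so that each of the first four positions differs
  -- from what the 4-cycle has there.
  z₀ z₁ z₂ z₃ far : V n
  z₀ = Vec.allFin n
  z₁ = swap z₀ 0F 1F
  z₂ = swap z₀ 2F 3F
  z₃ = swap z₁ 2F 3F
  far = swap (swap z₀ 0F 2F) 1F 3F

  square : List (V n)
  square = z₀ ∷ z₁ ∷ z₂ ∷ z₃ ∷ []

  -- A vertex of the square permutes positions within blocks.
  block : Fin n → ℕ
  block zero = 0
  block (suc zero) = 0
  block (suc (suc zero)) = 1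
  block (suc (suc (suc zero))) = 1
  block (suc (suc (suc (suc i)))) = 2 + toℕ i

  square-block : ∀ {x} → x ∈ square → ∀ i → block (lookup x i) ≡ block i
  square-block m (suc (suc (suc (suc i)))) = trans (cong block (tail-fixed m)) refl
    where
    rest : lookup z₀ (suc (suc (suc (suc i)))) ≡ suc (suc (suc (suc i)))
    rest = lookup-allFin (suc (suc (suc (suc i))))
    tail-fixed : ∀ {x} → x ∈ square → lookup x (suc (suc (suc (suc i)))) ≡ suc (suc (suc (suc i)))
    tail-fixed (here refl) = rest
    tail-fixed (there (here refl)) = rest
    tail-fixed (there (there (here refl))) = rest
    tail-fixed (there (there (there (here refl)))) = rest
  square-block (here refl) zero = refl
  square-block (here refl) (suc zero) = refl
  square-block (here refl) (suc (suc zero)) = refl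
  square-block (here refl) (suc (suc (suc zero))) = refl
  square-block (there (here refl)) zero = refl
  square-block (there (here refl)) (suc zero) = refl
  square-block (there (here refl)) (suc (suc zero)) = refl
  square-block (there (here refl)) (suc (suc (suc zero))) = refl
  square-block (there (there (here refl))) zero = refl
  square-block (there (there (here refl))) (suc zero) = refl
  square-block (there (there (here refl))) (suc (suc zero)) = refl
  square-block (there (there (here refl))) (suc (suc (suc zero))) = refl
  square-block (there (there (there (here refl)))) zero = refl
  square-block (there (there (there (here refl)))) (suc zero) = refl
  square-block (there (there (there (here refl)))) (suc (suc zero)) = refl
  square-block (there (there (there (here refl)))) (suc (suc (suc zero))) = refl

  swap-preserves-IsPerm : ∀ (x : V n) i j → toℕ i < toℕ j → IsPerm x → IsPerm (swap x i j)
  swap-preserves-IsPerm x i j i<j d = unique⇒distinct (~-unique (~-swapAt x i j i<j) (distinct⇒unique d))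

  z₀-IsPerm : IsPerm z₀
  z₀-IsPerm = unique⇒distinct {x = z₀} allFin-unique

  square-IsPerm : ∀ {x} → x ∈ square → IsPerm x
  square-IsPerm (here refl) = z₀-IsPerm
  square-IsPerm (there (here refl)) = swap-preserves-IsPerm z₀ 0F 1F (s≤s z≤n) z₀-IsPerm
  square-IsPerm (there (there (here refl))) = swap-preserves-IsPerm z₀ 2F 3F (s≤s (s≤s (s≤s z≤n))) z₀-IsPerm
  square-IsPerm (there (there (there (here refl)))) =
    swap-preserves-IsPerm z₁ 2F 3F (s≤s (s≤s (s≤s z≤n))) (swap-preserves-IsPerm z₀ 0F 1F (s≤s z≤n) z₀-IsPerm)

  far-IsPerm : IsPerm far
  far-IsPerm = swap-preserves-IsPerm (swap z₀ 0F 2F) 1F 3F (s≤s (s≤s z≤n))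
    (swap-preserves-IsPerm z₀ 0F 2F (s≤s z≤n) z₀-IsPerm)

  -- `leaving` consists of the 2n - 5 allowed pairs other than those two of the 4-cycle. Deleting
  -- them at three vertices would take 6n - 15 edges, one too many; `later` spares the edge of
  -- positions 1 and 2 at `z₃`.
  later leaving : List (Fin n × Fin n)
  later = map (λ j → 0F , suc (suc j)) (allFin (2 + k)) ++
    map (λ i → suc (suc (suc (inject₁ i))) , suc (suc (suc (suc i)))) (allFin k)
  leaving = (1F , 2F) ∷ later

  later-shape : ∀ {i j} → (i , j) ∈ later → Allowed i j × block i ≢ block j × (i , j) ≢ (1F , 2F)
  later-shape p with ∈-++⁻ (map (λ j → 0F , suc (suc j)) (allFin (2 + k))) p
  ... | inj₁ q with ∈-map⁻ (λ j → 0F , suc (suc j)) q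
  ...   | j , _ , refl = inj₂ (refl , s≤s z≤n) , differ j , λ ()
    where
    differ : ∀ (j : Fin (2 + k)) → 0 ≢ block (suc (suc j))
    differ zero ()
    differ (suc zero) ()
    differ (suc (suc j)) ()
  later-shape p | inj₂ q with ∈-map⁻ (λ i → suc (suc (suc (inject₁ i))) , suc (suc (suc (suc i)))) q
  ...   | i , _ , refl = inj₁ (cong (λ t → suc (suc (suc (suc t)))) (sym (FinP.toℕ-inject₁ i))) , differ i , λ ()
    where
    differ : ∀ (i : Fin k) → block (suc (suc (suc (inject₁ i)))) ≢ block (suc (suc (suc (suc i))))
    differ zero ()
    differ (suc i) e = <⇒≢ (n<1+n (toℕ i)) (trans (sym (FinP.toℕ-inject₁ i)) (suc-injective (suc-injective e)))

  leaving-shape : ∀ {i j} → (i , j) ∈ leaving → Allowed i j × block i ≢ block j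
  leaving-shape (here refl) = inj₁ refl , λ ()
  leaving-shape (there m) = let a , b , _ = later-shape m in a , b

  later-unique : Unique later
  later-unique = ++⁺ (map⁺ (λ { refl → refl }) (allFin⁺ (2 + k))) (map⁺ (λ { refl → refl }) (allFin⁺ k))
    λ (p , q) → clash (∈-map⁻ (λ j → 0F , suc (suc j)) p) (∈-map⁻ (λ i → suc (suc (suc (inject₁ i))) , suc (suc (suc (suc i)))) q)
    where
    clash : ∀ {g} → (∃ λ j → j ∈ allFin (2 + k) × g ≡ (0F , suc (suc j))) →
      (∃ λ i → i ∈ allFin k × g ≡ (suc (suc (suc (inject₁ i))) , suc (suc (suc (suc i))))) → ⊥
    clash (_ , _ , refl) (_ , _ , ())

  leaving-unique : Unique leaving
  leaving-unique = All.tabulate (λ m e → proj₂ (proj₂ (later-shape m)) (sym e)) ∷ later-unique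

  leaving-complete : ∀ {i j} → Allowed i j → block i ≢ block j → (i , j) ∈ leaving
  leaving-complete {_} {zero} (inj₁ ()) b
  leaving-complete {_} {zero} (inj₂ (_ , ())) b
  leaving-complete {zero} {suc zero} a b = contradiction refl b
  leaving-complete {zero} {suc (suc j)} a b = there (∈-++⁺ˡ (∈-map⁺ (λ j → 0F , suc (suc j)) (∈-allFin j)))
  leaving-complete {suc zero} {suc (suc zero)} a b = here refl
  leaving-complete {suc (suc zero)} {suc (suc (suc zero))} a b = contradiction refl b
  leaving-complete {suc (suc (suc i))} {suc (suc (suc (suc j)))} (inj₁ e) b =
    there (∈-++⁺ʳ (map (λ j → 0F , suc (suc j)) (allFin (2 + k)))
      (subst (λ i → (suc (suc (suc i)) , suc (suc (suc (suc j)))) ∈ _)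
        (FinP.toℕ-injective (trans (FinP.toℕ-inject₁ j) (suc-injective (suc-injective (suc-injective (suc-injective e))))))
        (∈-map⁺ (λ i → suc (suc (suc (inject₁ i))) , suc (suc (suc (suc i)))) (∈-allFin j))))
  leaving-complete {suc zero} {suc zero} (inj₁ ()) b
  leaving-complete {suc zero} {suc (suc (suc j))} (inj₁ ()) b
  leaving-complete {suc (suc zero)} {suc zero} (inj₁ ()) b
  leaving-complete {suc (suc zero)} {suc (suc zero)} (inj₁ ()) b
  leaving-complete {suc (suc zero)} {suc (suc (suc (suc j)))} (inj₁ ()) b
  leaving-complete {suc (suc (suc i))} {suc zero} (inj₁ ()) b
  leaving-complete {suc (suc (suc i))} {suc (suc zero)} (inj₁ ()) b
  leaving-complete {suc (suc (suc i))} {suc (suc (suc zero))} (inj₁ ()) b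

  length-later : length later ≡ 2 + 2 * k
  length-later = trans (length-++ (map (λ j → 0F , suc (suc j)) (allFin (2 + k))))
    (trans (cong₂ _+_ (trans (length-map _ (allFin (2 + k))) (length-tabulate {n = 2 + k} (λ i → i)))
      (trans (length-map _ (allFin k)) (length-tabulate {n = k} (λ i → i))))
    (cong (λ z → suc (suc (k + z))) (sym (+-identityʳ k))))

  starAt : V n × List (Fin n × Fin n) → List (Edge n)
  starAt (x , ps) = map (λ (i , j) → x , swap x i j) ps

  centres : List (V n × List (Fin n × Fin n))
  centres = (z₃ , later) ∷ (z₁ , leaving) ∷ (z₂ , leaving) ∷ []

  faults : List (Edge n)
  faults = concatMap starAt centres

  centre-square : ∀ {x ps} → (x , ps) ∈ centres → x ∈ square × x ≢ z₀ × x ≢ far × ps ⊆ leaving × Unique ps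
  centre-square (here refl) = there (there (there (here refl))) , (λ ()) , (λ ()) , there , later-unique
  centre-square (there (here refl)) = there (here refl) , (λ ()) , (λ ()) , (λ m → m) , leaving-unique
  centre-square (there (there (here refl))) = there (there (here refl)) , (λ ()) , (λ ()) , (λ m → m) , leaving-unique

  FaultShape : V n → V n → Set
  FaultShape x y = ∃ λ ps → (x , ps) ∈ centres × ∃ λ ij → ij ∈ ps × y ≡ swap x (proj₁ ij) (proj₂ ij)

  faults⁻ : ∀ {x y} → (x , y) ∈ faults → FaultShape x y
  faults⁻ m with find (∈-concatMap⁻ starAt {xs = centres} m)
  ... | (x , ps) , c∈ , m′ with ∈-map⁻ (λ (i , j) → x , swap x i j) m′
  ...   | ij , g , refl = ps , c∈ , ij , g , refl

  -- Position `i` receives a letter from the block of `j`, which no vertex of the square has there.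
  leave : ∀ {x i j} → x ∈ square → (i , j) ∈ leaving → swap x i j ∉ square
  leave {x} {i} {j} m g m′ = proj₂ (leaving-shape g)
    (trans (sym (square-block m′ i)) (trans (cong block (lookup-swapAtˡ x i j)) (square-block m j)))

  fault-source : ∀ {x y} → (x , y) ∈ faults → x ∈ square × x ≢ z₀ × x ≢ far
  fault-source m = let _ , c∈ , _ = faults⁻ m
                       s , ne , nf , _ = centre-square c∈ in s , ne , nf

  fault-target : ∀ {x y} → (x , y) ∈ faults → y ∉ square
  fault-target m with faults⁻ m
  ... | ps , c∈ , (i , j) , g , refl = let s , _ , _ , sub , _ = centre-square c∈ in leave s (sub g)

  fault-Adj : ∀ {x y} → (x , y) ∈ faults → Adj x y
  fault-Adj m with faults⁻ m
  ... | ps , c∈ , (i , j) , g , refl = let s , _ , _ , sub , _ = centre-square c∈ in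
        swap-Adj (square-IsPerm s) (proj₁ (leaving-shape (sub g)))

  faults-IsEdgeSet : IsEdgeSet faults
  faults-IsEdgeSet x y m = square-IsPerm (proj₁ (fault-source m)) , fault-Adj m

  faults-unique : Unique faults
  faults-unique = unique-concatMap proj₁ proj₁
    (((λ ()) ∷ (λ ()) ∷ []) ∷ ((λ ()) ∷ []) ∷ [] ∷ [])
    (λ {(x , ps)} c∈ → let s , _ , _ , sub , u = centre-square c∈ in
      unique-map (λ g h e → swapAt-injective x (square-IsPerm s) (allowed-< (proj₁ (leaving-shape (sub g))))
        (allowed-< (proj₁ (leaving-shape (sub h)))) (cong proj₂ e)) u)
    (λ {(x , ps)} _ m → source x (∈-map⁻ (λ (i , j) → x , swap x i j) m))
    where
    source : ∀ (x : V n) {ps} {a : Edge n} → (∃ λ ij → ij ∈ ps × a ≡ (x , swap x (proj₁ ij) (proj₂ ij))) → proj₁ a ≡ x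
    source x (_ , _ , refl) = refl

  faults-distinct : AllPairs (λ e f → ¬ SameEdge e f) faults
  faults-distinct = allPairs-from faults-unique λ m m′ ne →
    λ { (inj₁ (refl , refl)) → ne refl
      ; (inj₂ (refl , refl)) → fault-target m′ (proj₁ (fault-source m)) }

  length-faults : length faults ≡ 6 * n ∸ 16
  length-faults = begin
    length faults                                               ≡⟨ ∑-1 faults ⟨
    ∑ faults (λ _ → 1)                                          ≡⟨ ∑-concatMap centres starAt (λ _ → 1) ⟩
    ∑ centres (λ c → ∑ (starAt c) (λ _ → 1))                    ≡⟨ ∑-cong centres (λ (x , ps) → trans (∑-1 (starAt (x , ps))) (length-map _ ps)) ⟩
    length later + (suc (length later) + (suc (length later) + 0)) ≡⟨ cong (λ l → l + (suc l + (suc l + 0))) length-later ⟩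
    2 + 2 * k + (suc (2 + 2 * k) + (suc (2 + 2 * k) + 0))       ≡⟨ identity k ⟩
    8 + 6 * k                                                   ≡⟨ cong (_∸ 16) (*-distribˡ-+ 6 4 k) ⟨
    6 * n ∸ 16                                                  ∎
    where
    open ≡-Reasoning
    identity : ∀ k → 2 + 2 * k + (suc (2 + 2 * k) + (suc (2 + 2 * k) + 0)) ≡ 8 + 6 * k
    identity = solve-∀

  _∈□?_ : ∀ (x : V n) xs → Dec (x ∈ xs)
  _∈□?_ = ∈?-dec _≟V_

  allNeighbours : V n → List (V n)
  allNeighbours x = map (λ p → swap x (proj₁ p) (proj₂ p)) (allowedPairs (2 + k))

  allNeighbours-unique : ∀ x → IsPerm x → Unique (allNeighbours x)
  allNeighbours-unique x d = unique-map (λ g h → swapAt-injective x d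
    (allowed-< (allowedPairs-sound (2 + k) g)) (allowed-< (allowedPairs-sound (2 + k) h))) (allowedPairs-unique (2 + k))

  allNeighbours-Adj : ∀ x {y} → IsPerm x → y ∈ allNeighbours x → Adj x y
  allNeighbours-Adj x d m with ∈-map⁻ (λ p → swap x (proj₁ p) (proj₂ p)) m
  ... | (i , j) , g , refl = swap-Adj d (allowedPairs-sound (2 + k) g)

  length-allNeighbours : ∀ x → length (allNeighbours x) ≡ 5 + 2 * k
  length-allNeighbours x = trans (length-map _ (allowedPairs (2 + k)))
    (trans (length-allowedPairs (2 + k)) (cong suc (*-distribˡ-+ 2 2 k)))

  full-degree : ∀ {x} → IsPerm x → (∀ {y} → Adj x y → ¬ EdgeIn faults x y) → 5 + 2 * k ≤ deg faults x
  full-degree {x} d h = subst (_≤ deg faults x) (length-allNeighbours x)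
    (deg≥ faults (allNeighbours-unique x d) (λ m → let a = allNeighbours-Adj x d m in a , h a))

  z₀-degree : 5 + 2 * k ≤ deg faults z₀
  z₀-degree = full-degree z₀-IsPerm λ _ → λ
    { (inj₁ m) → proj₁ (proj₂ (fault-source m)) refl
    ; (inj₂ m) → fault-target m (here refl) }

  unmoved : ∀ {i j} → swap far i j ∈ square → ∀ l → l ≢ i → l ≢ j → block (lookup far l) ≢ block l → ⊥
  unmoved m l p q ne = ne (trans (cong block (sym (lookup-swapAt-other far p q))) (square-block m l))

  -- A single swap repairs at most two of the displaced positions 0, 1, 2.
  far-isolated : ∀ {x} → Adj far x → x ∉ square
  far-isolated {x} (_ , i , j , a , refl) m
    with i Fin.≟ 0F | j Fin.≟ 0F | i Fin.≟ 1F | j Fin.≟ 1F | i Fin.≟ 2F | j Fin.≟ 2F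
  ... | no p | no q | _ | _ | _ | _ = unmoved m 0F (λ e → p (sym e)) (λ e → q (sym e)) λ ()
  ... | _ | _ | no p | no q | _ | _ = unmoved m 1F (λ e → p (sym e)) (λ e → q (sym e)) λ ()
  ... | _ | _ | _ | _ | no p | no q = unmoved m 2F (λ e → p (sym e)) (λ e → q (sym e)) λ ()
  ... | yes refl | _ | _ | yes refl | yes () | _
  ... | yes refl | _ | yes () | _ | _ | _
  ... | yes refl | _ | no _ | yes refl | no _ | yes ()
  ... | _ | yes refl | _ | yes () | _ | _
  ... | _ | yes refl | yes refl | _ | yes () | _
  ... | _ | yes refl | yes refl | _ | _ | yes ()

  far-degree : 5 + 2 * k ≤ deg faults far
  far-degree = full-degree far-IsPerm λ a → λ
    { (inj₁ m) → proj₂ (proj₂ (fault-source m)) refl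
    ; (inj₂ m) → far-isolated a (proj₁ (fault-source m)) }

  square-cycle : ∀ {x} → x ∈ square → swap x 0F 1F ∈ square × swap x 2F 3F ∈ square
  square-cycle (here refl) = there (here refl) , there (there (here refl))
  square-cycle (there (here refl)) = here refl , there (there (there (here refl)))
  square-cycle (there (there (here refl))) = there (there (there (here refl))) , here refl
  square-cycle (there (there (there (here refl)))) = there (there (here refl)) , there (here refl)

  square-exit : ∀ {x i j} → x ∈ square → Allowed i j → swap x i j ∉ square → (i , j) ∈ leaving
  square-exit {x} {i} {j} m a out = leaving-complete a λ e → out (stay i j a e)
    where
    stay : ∀ i j → Allowed i j → block i ≡ block j → swap x i j ∈ square
    stay _ zero (inj₁ ()) e
    stay _ zero (inj₂ (_ , ())) e
    stay zero (suc zero) a e = proj₁ (square-cycle m)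
    stay zero (suc (suc zero)) a ()
    stay zero (suc (suc (suc zero))) a ()
    stay zero (suc (suc (suc (suc j)))) a ()
    stay (suc zero) (suc zero) (inj₁ ()) e
    stay (suc zero) (suc (suc zero)) a ()
    stay (suc zero) (suc (suc (suc zero))) a ()
    stay (suc zero) (suc (suc (suc (suc j)))) a ()
    stay (suc (suc zero)) (suc zero) (inj₁ ()) e
    stay (suc (suc zero)) (suc (suc zero)) (inj₁ ()) e
    stay (suc (suc zero)) (suc (suc (suc zero))) a e = proj₂ (square-cycle m)
    stay (suc (suc zero)) (suc (suc (suc (suc j)))) a ()
    stay (suc (suc (suc i))) (suc (suc (suc (suc j)))) (inj₁ e) b = contradiction b (differ i j
      (suc-injective (suc-injective (suc-injective e))))
      where
      differ : ∀ (i : Fin (suc k)) (j : Fin k) → suc (toℕ j) ≡ suc (toℕ i) → block (suc (suc (suc i))) ≢ block (suc (suc (suc (suc j))))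
      differ zero j e ()
      differ (suc i) j e b = 1+n≢n (trans (sym (suc-injective e)) (sym (suc-injective (suc-injective b))))
    stay (suc (suc (suc i))) (suc zero) (inj₁ ()) e
    stay (suc (suc (suc i))) (suc (suc zero)) (inj₁ ()) e
    stay (suc (suc (suc i))) (suc (suc (suc zero))) (inj₁ ()) e

  -- The two edges of the 4-cycle at `x` survive, as every fault has an end outside the square.
  square-degree : ∀ {x} → x ∈ square → 2 ≤ deg faults x
  square-degree {x} m = deg≥ faults {ys = swap x 0F 1F ∷ swap x 2F 3F ∷ []}
    (((λ e → contradiction (swapAt-injective x d (s≤s z≤n) (s≤s (s≤s (s≤s z≤n))) e) λ ()) ∷ []) ∷ [] ∷ [])
    λ { (here refl) → swap-Adj d (inj₁ refl) , inner (proj₁ (square-cycle m))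
      ; (there (here refl)) → swap-Adj d (inj₁ refl) , inner (proj₂ (square-cycle m)) }
    where
    d = square-IsPerm m
    inner : ∀ {y} → y ∈ square → ¬ EdgeIn faults x y
    inner m′ (inj₁ f) = fault-target f m′
    inner m′ (inj₂ f) = fault-target f m

  -- Outside the square only the neighbours z₁, z₂, z₃ can be lost.
  outside-degree : ∀ {x} → IsPerm x → x ∉ square → 2 ≤ deg faults x
  outside-degree {x} d x∉ = ≤-trans enough
    (deg≥ faults (filter⁺ (λ y → ¬? (y ∈□? square′)) (allNeighbours-unique x d)) λ {y} m →
      let m′ , y∉ = ∈-filter⁻ (λ y → ¬? (y ∈□? square′)) {xs = allNeighbours x} m in
      allNeighbours-Adj x d m′ , λ { (inj₁ f) → x∉ (proj₁ (fault-source f))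
                                 ; (inj₂ f) → y∉ (faulty f) })
    where
    square′ kept lost : List (V n)
    square′ = z₁ ∷ z₂ ∷ z₃ ∷ []
    kept = filter (λ y → ¬? (y ∈□? square′)) (allNeighbours x)
    lost = filter (λ y → y ∈□? square′) (allNeighbours x)
    faulty : ∀ {y z} → (y , z) ∈ faults → y ∈ square′
    faulty f with fault-source f
    ... | here refl , ne , _ = contradiction refl ne
    ... | there m , _ = m
    split : ∀ (xs : List (V n)) → length xs ≡
      length (filter (λ y → ¬? (y ∈□? square′)) xs) + length (filter (λ y → y ∈□? square′) xs)
    split [] = refl
    split (y ∷ xs) with does (y ∈□? square′)
    ... | true = trans (cong suc (split xs)) (sym (+-suc _ _))
    ... | false = cong suc (split xs)
    lost≤3 : length lost ≤ 3
    lost≤3 = length-⊆ (filter⁺ (λ y → y ∈□? square′) (allNeighbours-unique x d))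
      (λ m → proj₂ (∈-filter⁻ (λ y → y ∈□? square′) {xs = allNeighbours x} m))
    enough : 2 ≤ length kept
    enough = +-cancelʳ-≤ 3 2 _ (≤-trans (m≤m+n 5 (2 * k)) (≤-trans
      (≤-reflexive (trans (sym (length-allNeighbours x)) (split (allNeighbours x)))) (+-monoʳ-≤ (length kept) lost≤3)))

  faults-MinDeg : MinDeg≥2 faults
  faults-MinDeg x d with x ∈□? square
  ... | yes m = square-degree m
  ... | no ∉ = outside-degree d ∉

  -- The edges of the cut around the square that survive: the 2n - 5 at `z₀` and the spared one at
  -- `z₃`, one less than the degree of `z₀` and `far`.
  exits : List (Edge n)
  exits = (z₃ , swap z₃ 1F 2F) ∷ starAt (z₀ , leaving)

  length-exits : length exits ≡ 4 + 2 * k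
  length-exits = cong suc (trans (length-map _ leaving) (cong suc length-later))

  exit-∈ : ∀ {x y} → x ∈ square → y ∉ square → Adj x y → ¬ EdgeIn faults x y → (x , y) ∈ exits
  exit-∈ {x} m y∉ (_ , i , j , a , refl) ¬F = place m (square-exit m a y∉)
    where
    lies : ∀ {x ps i j} → (x , ps) ∈ centres → (i , j) ∈ ps → (x , swap x i j) ∈ faults
    lies {x} c g = ∈-concatMap⁺ starAt (lose c (∈-map⁺ (λ (i , j) → x , swap x i j) g))
    place : x ∈ square → (i , j) ∈ leaving → (x , swap x i j) ∈ exits
    place (here refl) g = there (∈-map⁺ (λ (i , j) → z₀ , swap z₀ i j) g)
    place (there (here refl)) g = contradiction (inj₁ (lies (there (here refl)) g)) ¬F
    place (there (there (here refl))) g = contradiction (inj₁ (lies (there (there (here refl))) g)) ¬F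
    place (there (there (there (here refl)))) (here refl) = here refl
    place (there (there (there (here refl)))) (there g) = contradiction (inj₁ (lies (here refl) g)) ¬F

  exit-on-walk : ∀ {x v p} → Walk faults x v p → x ∈ square → v ∉ square → ∃ λ e → e ∈ edgesOf p × e ∈ exits
  exit-on-walk here m v∉ = contradiction m v∉
  exit-on-walk (step {w = y} a ¬F w) m v∉ with y ∈□? square
  ... | no y∉ = _ , first w , exit-∈ m y∉ a ¬F
    where
    first : ∀ {x y v p} → Walk faults y v p → (x , y) ∈ edgesOf (x ∷ p)
    first here = here refl
    first (step _ _ _) = here refl
  ... | yes y∈ = let e , e∈ , e∈′ = exit-on-walk w y∈ v∉ in e , later-edge w e∈ , e∈′
    where
    later-edge : ∀ {x y v p e} → Walk faults y v p → e ∈ edgesOf p → e ∈ edgesOf (x ∷ p)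
    later-edge here ()
    later-edge (step _ _ _) m = there m

  -- Every path from `z₀` must leave the square, and an exit common to two paths would be a shared
  -- edge. Hence there are at most as many paths as exits.
  choose-exits : ∀ {v} → v ∉ square → ∀ ps → All (IsPath faults z₀ v) ps → AllPairs EdgeDisjoint ps →
    ∃ λ es → length es ≡ length ps × Unique es × es ⊆ exits × (∀ {e} → e ∈ es → ∃ λ p → p ∈ ps × e ∈ edgesOf p)
  choose-exits v∉ [] [] [] = [] , refl , [] , (λ ()) , λ ()
  choose-exits v∉ (p ∷ ps) ((w , _) ∷ paths) (dis ∷ disj) =
    let e , e∈p , e∈exits = exit-on-walk w (here refl) v∉
        es , len , u , sub , on = choose-exits v∉ ps paths disj
    in e ∷ es , cong suc len
       , All.tabulate (λ m eq → let q , q∈ , m′ = on m in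
           All.lookup dis q∈ e _ e∈p m′ (subst (SameEdge e) eq (inj₁ (refl , refl)))) ∷ u
       , (λ { (here refl) → e∈exits ; (there m) → sub m })
       , λ { (here refl) → p , here refl , e∈p ; (there m) → let q , q∈ , m′ = on m in q , there q∈ , m′ }

  not-stronglyMenger : ¬ StronglyMengerEdge faults
  not-stronglyMenger menger =
    let ps , len , paths , disj = menger z₀ far z₀-IsPerm far-IsPerm (λ ())
        es , len′ , u , sub , _ = choose-exits far∉ ps paths disj
        too-many = begin
          5 + 2 * k                        ≤⟨ ⊓-glb z₀-degree far-degree ⟩
          deg faults z₀ ⊓ deg faults far   ≡⟨ trans len′ len ⟨
          length es                        ≤⟨ length-⊆ u sub ⟩
          length exits                     ≡⟨ length-exits ⟩
          4 + 2 * k                        ∎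
    in 1+n≰n too-many
    where
    open ≤-Reasoning
    far∉ : far ∉ square
    far∉ m = contradiction (square-block m 0F) λ ()

theorem4p1 : (n : ℕ) → 4 ≤ n →
    ((F : List (Edge n)) → IsEdgeSet F → length F ≤ 6 * n ∸ 17 → MinDeg≥2 F →
    StronglyMengerEdge F)
    ×
    Σ (List (Edge n)) λ F →
    IsEdgeSet F × AllPairs (λ e f → ¬ SameEdge e f) F × length F ≡ 6 * n ∸ 16 ×
    MinDeg≥2 F × ¬ StronglyMengerEdge F
theorem4p1 n 4≤n with m≤n⇒∃[o]m+o≡n 4≤n
... | k , refl =
  (λ F _ F≤ δ≥2 → FaultyGraph.stronglyMenger F F≤ δ≥2) ,
  faults , faults-IsEdgeSet , faults-distinct , length-faults , faults-MinDeg , not-stronglyMenger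
  where open Sharp k
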